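{- Let $n\ge 1$ be an integer. A tree $T$ is an $n$-cube visibility graph if and only if $T$ is the union of $n$ subgraphs each of which is an $(n-1)$-cube orthogonal visibility forest.
   Context: All graphs are finite and simple. An $m$-cube is an $m$-dimensional (closed) unit hypercube; $\mathbf e_1,\mathbf e_2,\dots$ denote standard basis vectors. A graph $G$ is an $n$-cube visibility graph if its vertices can be assigned to pairwise disjoint axis-aligned unit $n$-cubes in $\mathbb{R}^n$ (one cube per vertex) such that two vertices are adjacent if and only if there is an uninterrupted axis-aligned cylindrical channel of positive diameter (parallel to some $\mathbf e_i$, $1\le i\le n$) between their cubes; uninterrupted means that it intersects none of the other cubes. A graph $G$ is an $m$-cube orthogonal visibility graph if its vertices can be assigned to pairwise disjoint unit $m$-cubes in $\mathbb{R}^{m+1}$ aligned with the first $m$ axes, i.e. sets of the form $\prod_{i=1}^m[a_i,a_i+1]\times\{c\}$ (one per vertex), such that two vertices are adjacent if and only if there is a cylindrical channel of positive diameter parallel to $\mathbf e_{m+1}$ between their cubes that intersects none of the other cubes. (For $m=0$ the objects are distinct points of $\mathbb{R}$, and two points see each other when no other point of the representation lies strictly between them.) An $m$-cube orthogonal visibility forest is a graph that is a disjoint union of trees each of which is an $m$-cube orthogonal visibility graph. -}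

module Defs where

open import Algebra.Bundles using (CommutativeRing)
import Algebra.Properties.CommutativeMonoid.Sum as Sum
open import Data.Fin using (Fin; fromℕ)
open import Data.List using (List; _∷_; [_]; _++_; length)
open import Data.List.Relation.Unary.Linked using (Linked)
open import Data.List.Relation.Unary.Unique.Propositional using (Unique)
open import Data.Nat as ℕ using (ℕ; suc)
open import Data.Product using (∃-syntax; Σ-syntax; _×_)
open import Data.Sum using (_⊎_)
open import Data.Vec.Functional using (Vector; init; last; updateAt)
open import Function.Base using (const)
open import Function.Bundles using (_⇔_)
open import Level using (0ℓ) renaming (suc to lsuc)
open import Relation.Binary.Core using (Rel)
open import Relation.Binary.Construct.Closure.ReflexiveTransitive using (Star)
import Relation.Binary.Construct.StrictToNonStrict as StrictToNonStrict
open import Relation.Binary.PropositionalEquality using (_≢_)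
open import Relation.Binary.Structures using (IsStrictTotalOrder)
open import Relation.Nullary using (¬_)
open import Relation.Unary using (Pred; _∈_; _⊆_; _⊥_; Satisfiable)

-- The classical real numbers, given by the axioms that characterise them up to
-- isomorphism.  Suprema are approximated from within by elements of the set;
-- for a trichotomous order this form of completeness entails excluded middle
-- for types in Set.
record CompleteOrderedField : Set (lsuc 0ℓ) where
  field
    commutativeRing : CommutativeRing 0ℓ 0ℓ

  open CommutativeRing commutativeRing public

  infix 4 _<_

  field
    _<_                : Rel Carrier 0ℓ
    isStrictTotalOrder : IsStrictTotalOrder _≈_ _<_
    0<1                : 0# < 1#
    +-monoʳ-<          : ∀ x {y z} → y < z → x + y < x + z
    *-pos              : ∀ {x y} → 0# < x → 0# < y → 0# < x * y
    inverse            : ∀ x → ¬ (x ≈ 0#) → ∃[ y ] x * y ≈ 1#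

  open StrictToNonStrict _≈_ _<_ public using (_≤_)

  field
    supremum : (S : Pred Carrier 0ℓ) → Satisfiable S →
               (∃[ b ] (∀ {x} → x ∈ S → x ≤ b)) →
               ∃[ s ] (∀ {x} → x ∈ S → x ≤ s) ×
                      (∀ {y} → y < s → ∃[ x ] x ∈ S × y < x)

-- Finite simple graphs whose vertices are drawn from Fin k, not necessarily
-- exhausting it, so that a graph and its subgraphs share one ambient set.
record Graph (k : ℕ) : Set (lsuc 0ℓ) where
  field
    V          : Pred (Fin k) 0ℓ
    Adj        : Rel (Fin k) 0ℓ
    Adj⇒V      : ∀ {u v} → Adj u v → u ∈ V
    Adj-sym    : ∀ {u v} → Adj u v → Adj v u
    Adj-irrefl : ∀ {v} → ¬ Adj v v

open Graph public

module _ {k : ℕ} where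

  record _IsSubgraphOf_ (H G : Graph k) : Set where
    field
      V-⊆   : V H ⊆ V G
      Adj-⊆ : ∀ {u v} → Adj H u v → Adj G u v

  record _IsUnionOf_ (G : Graph k) {n : ℕ} (H : Fin n → Graph k) : Set where
    field
      subgraph  : ∀ i → H i IsSubgraphOf G
      V-cover   : ∀ {v} → v ∈ V G → ∃[ i ] v ∈ V (H i)
      Adj-cover : ∀ {u v} → Adj G u v → ∃[ i ] Adj (H i) u v

  IsConnected : Graph k → Set
  IsConnected G = Satisfiable (V G) ×
                  (∀ {u v} → u ∈ V G → v ∈ V G → Star (Adj G) u v)

  -- v ∷ vs lists the vertices of a cycle in cyclic order.
  record IsCycle (G : Graph k) (v : Fin k) (vs : List (Fin k)) : Set where
    field
      length≥3 : 3 ℕ.≤ length (v ∷ vs)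
      distinct : Unique (v ∷ vs)
      closed   : Linked (Adj G) (v ∷ vs ++ [ v ])

  IsAcyclic : Graph k → Set
  IsAcyclic G = ∀ v vs → ¬ IsCycle G v vs

  IsTree : Graph k → Set
  IsTree G = IsConnected G × IsAcyclic G

module Visibility (ℝ : CompleteOrderedField) where
  open CompleteOrderedField ℝ
  open Sum +-commutativeMonoid using (sum)

  Point : ℕ → Set
  Point d = Vector Carrier d

  -- Sets of points are given by predicates.
  Region : ℕ → Set₁
  Region d = Pred (Point d) 0ℓ

  Cube : ∀ {d} → Point d → Region d
  Cube a x = ∀ i → a i ≤ x i × x i ≤ a i + 1#

  -- The unit m-cube in ℝ^(m+1) parallel to the first m axes.
  Panel : ∀ {m} → Point (suc m) → Region (suc m)
  Panel a x = init x ∈ Cube (init a) × last x ≈ last a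

  -- Squared Euclidean distance from x to the line through p parallel to the
  -- i-th axis: the i-th summand is replaced by 0.
  distToAxis² : ∀ {d} → Fin d → Point d → Point d → Carrier
  distToAxis² i p x =
    sum (updateAt (λ j → (x j - p j) * (x j - p j)) i (const 0#))

  -- Closed round cylinders parallel to the i-th axis.  The i-th coordinate of
  -- centre is irrelevant.  In dimension 1 the cross-section is a single point.
  record Cylinder {d : ℕ} (i : Fin d) : Set where
    field
      centre    : Point d
      radius    : Carrier
      radius>0  : 0# < radius
      start end : Carrier
      start<end : start < end

    Base : Carrier → Region d
    Base s x = x i ≈ s × distToAxis² i centre x ≤ radius * radius

    Solid : Region d
    Solid x = (start ≤ x i × x i ≤ end) ×
              distToAxis² i centre x ≤ radius * radius

  Joins : ∀ {d} {i : Fin d} → Cylinder i → Region d → Region d → Set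
  Joins C A B = (Base start ⊆ A × Base end ⊆ B) ⊎ (Base start ⊆ B × Base end ⊆ A)
    where open Cylinder C

  -- In what follows the family O of regions is indexed by all of Fin k, but
  -- only its members at vertices of G play a role.
  module _ {k d : ℕ} (G : Graph k) (O : Fin k → Region d) where

    PairwiseDisjoint : Set
    PairwiseDisjoint = ∀ {u v} → u ∈ V G → v ∈ V G → u ≢ v → O u ⊥ O v

    SeesAlong : Fin d → Fin k → Fin k → Set
    SeesAlong i u v = Σ[ C ∈ Cylinder i ]
      Joins C (O u) (O v) ×
      (∀ {w} → w ∈ V G → w ≢ u → w ≢ v → Cylinder.Solid C ⊥ O w)

  IsCubeVisibilityGraph : (n : ℕ) {k : ℕ} → Graph k → Set
  IsCubeVisibilityGraph n {k} G = Σ[ a ∈ (Fin k → Point n) ]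
    let O = λ v → Cube (a v) in
    PairwiseDisjoint G O ×
    (∀ {u v} → u ∈ V G → v ∈ V G → u ≢ v →
       Adj G u v ⇔ (∃[ i ] SeesAlong G O i u v))

  IsOrthogonalVisibilityGraph : (m : ℕ) {k : ℕ} → Graph k → Set
  IsOrthogonalVisibilityGraph m {k} G = Σ[ a ∈ (Fin k → Point (suc m)) ]
    let O = λ v → Panel (a v) in
    PairwiseDisjoint G O ×
    (∀ {u v} → u ∈ V G → v ∈ V G → u ≢ v →
       Adj G u v ⇔ SeesAlong G O (fromℕ m) u v)

  IsOrthogonalVisibilityForest : (m : ℕ) {k : ℕ} → Graph k → Set₁
  IsOrthogonalVisibilityForest m {k} F =
    Σ[ l ∈ ℕ ] Σ[ K ∈ (Fin l → Graph k) ]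
      F IsUnionOf K ×
      (∀ {i j} → i ≢ j → V (K i) ⊥ V (K j)) ×
      (∀ i → IsTree (K i) × IsOrthogonalVisibilityGraph m (K i))

{-# OPTIONS --safe #-}
-- Visibility along the i-th axis depends only on the order in which the lines parallel to that axis
-- meet the objects, so unit cubes may be traded for their bottom panels.
--
-- Given cubes, the i-th subgraph consists of the pairs seeing each other along the i-th axis.  On a
-- line through u, the next object above u is seen by u, hence lies in the same component as u;
-- so no other component can block a view between two members of a component.
--
-- Conversely, colour every edge with one subgraph containing it.  Adding up, along the paths of the
-- tree, the displacements prescribed by the panel representations gives lateral positions P and
-- heights φ; the i-th coordinate of a vertex is P plus a large multiple of the rank of φ, ties
-- between vertices separated by an edge of colour i being broken arbitrarily.  Two vertices not
-- joined by a path of a single colour then differ by more than 1 in two coordinates, so that their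
-- cubes neither meet, nor see, nor block the views along an axis of each other's neighbours.
module Submission where

open import Defs
import Algebra.Properties.CommutativeMonoid.Sum as Sum
import Algebra.Properties.Ring as RingProperties
open import Data.Fin using (Fin; zero; suc; fromℕ; combine; remQuot) renaming (_<_ to _<ᶠ_)
open import Data.Fin.Induction using (spo-wellFounded; spo-noetherian) renaming (<-wellFounded to <ᶠ-wellFounded)
open import Data.Fin.Permutation.Components using (transpose; transpose-inverse)
open import Data.Fin.Properties using (_≟_; fromℕ≢inject₁; remQuot-combine; combine-remQuot)
  renaming (<-cmp to <ᶠ-cmp; <-trans to <ᶠ-trans; <-irrefl to <ᶠ-irrefl)
open import Data.Fin.Relation.Unary.Top using (view; ‵fromℕ; ‵inject₁)
open import Data.List using (List; []; _∷_; [_]; _++_; length; filter; allFin; lookup)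
open import Data.List.Membership.DecPropositional using () renaming (_∈?_ to member?)
open import Data.List.Membership.Propositional using () renaming (_∈_ to _∈ᴸ_; _∉_ to _∉ᴸ_)
open import Data.List.Membership.Propositional.Properties using (∈-filter⁺; ∈-filter⁻; ∈-allFin; ∈-lookup)
open import Data.List.Relation.Unary.All as All using ([]; _∷_)
open import Data.List.Relation.Unary.All.Properties using (¬Any⇒All¬)
open import Data.List.Relation.Unary.AllPairs using ([]; _∷_)
open import Data.List.Relation.Unary.Any using (here; there; index)
open import Data.List.Relation.Unary.Any.Properties using (lookup-index)
open import Data.List.Relation.Unary.Linked as Linked using (Linked; [-]; _∷_)
open import Data.List.Relation.Unary.Unique.Propositional using (Unique)
open import Data.List.Relation.Unary.Unique.Propositional.Properties using (filter⁺; allFin⁺)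
open import Data.Nat using (ℕ; s≤s; z≤n) renaming (_*_ to _*ᴺ_)
open import Data.Product using (∃-syntax; Σ-syntax; _×_; _,_; proj₁; proj₂)
open import Data.Sum using (_⊎_; inj₁; inj₂; swap; [_,_]′) renaming (map to ⊎-map)
open import Data.Vec.Functional using (Vector; updateAt)
open import Data.Vec.Functional.Properties using (updateAt-updates; updateAt-minimal)
open import Function.Base using (_∘_; const; id; flip)
open import Function.Bundles using (_⇔_; mk⇔; Equivalence)
open import Induction.WellFounded using (WellFounded; Acc; acc)
open import Level using (0ℓ)
open import Relation.Binary.Bundles using (StrictTotalOrder)
open import Relation.Binary.Construct.Closure.ReflexiveTransitive as Star using (Star; ε; _◅_; _◅◅_)
import Relation.Binary.Construct.On as On
import Relation.Binary.Construct.StrictToNonStrict as StrictToNonStrict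
open import Relation.Binary.Core using (Rel)
open import Relation.Binary.Definitions using (Symmetric; tri<; tri≈; tri>)
import Relation.Binary.Properties.StrictTotalOrder as STOProperties
open import Relation.Binary.PropositionalEquality as ≡ using (_≡_; _≢_)
import Relation.Binary.Reasoning.StrictPartialOrder as SPOReasoning
open import Relation.Binary.Structures using (IsEquivalence; IsStrictTotalOrder)
open import Relation.Nullary using (¬_; Dec; yes; no; contradiction)
open import Relation.Nullary.Decidable using (dec-true; decidable-stable)
open import Relation.Unary using (Pred; _∈_; _⊆_; _⊥_)

-- Ordered field arithmetic, and the classical logic that completeness provides.

module OrderedField (ℝ : CompleteOrderedField) where
  open CompleteOrderedField ℝ hiding (zero) public
  open IsStrictTotalOrder isStrictTotalOrder public
    using (compare; <-respˡ-≈; <-respʳ-≈)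
    renaming (trans to <-trans; irrefl to <-irrefl)

  strictTotalOrder : StrictTotalOrder _ _ _
  strictTotalOrder = record { isStrictTotalOrder = isStrictTotalOrder }

  open StrictTotalOrder strictTotalOrder using (strictPartialOrder)
  open STOProperties strictTotalOrder public
    using () renaming (refl to ≤-refl; trans to ≤-trans; antisym to ≤-antisym; total to ≤-total)
  module ≤-Reasoning = SPOReasoning strictPartialOrder
  open RingProperties ring public using (-‿distribˡ-*; -‿distribʳ-*; -‿involutive)

  <⇒≤ : ∀ {x y} → x < y → x ≤ y
  <⇒≤ = inj₁

  ≈⇒≤ : ∀ {x y} → x ≈ y → x ≤ y
  ≈⇒≤ = inj₂

  ≡⇒≈ : ∀ {x y} → x ≡ y → x ≈ y
  ≡⇒≈ ≡.refl = refl

  <-≤-trans : ∀ {x y z} → x < y → y ≤ z → x < z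
  <-≤-trans = StrictToNonStrict.<-≤-trans _≈_ _<_ <-trans <-respʳ-≈

  ≤-<-trans : ∀ {x y z} → x ≤ y → y < z → x < z
  ≤-<-trans = StrictToNonStrict.≤-<-trans _≈_ _<_ sym <-trans <-respˡ-≈

  <⇒≱ : ∀ {x y} → x < y → ¬ (y ≤ x)
  <⇒≱ x<y y≤x = <-irrefl refl (<-≤-trans x<y y≤x)

  <-or-≥ : ∀ x y → x < y ⊎ y ≤ x
  <-or-≥ x y with compare x y
  ... | tri< x<y _ _ = inj₁ x<y
  ... | tri≈ _ x≈y _ = inj₂ (inj₂ (sym x≈y))
  ... | tri> _ _ y<x = inj₂ (inj₁ y<x)

  ≮⇒≥ : ∀ {x y} → ¬ (x < y) → y ≤ x
  ≮⇒≥ {x} {y} x≮y with <-or-≥ x y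
  ... | inj₁ x<y = contradiction x<y x≮y
  ... | inj₂ y≤x = y≤x

  ≰⇒> : ∀ {x y} → ¬ (x ≤ y) → y < x
  ≰⇒> {x} {y} x≰y with <-or-≥ y x
  ... | inj₁ y<x = y<x
  ... | inj₂ x≤y = contradiction x≤y x≰y

  ≤∧≉⇒< : ∀ {x y} → x ≤ y → ¬ (x ≈ y) → x < y
  ≤∧≉⇒< (inj₁ x<y) _ = x<y
  ≤∧≉⇒< (inj₂ x≈y) x≉y = contradiction x≈y x≉y

  ≉⇒<⊎> : ∀ {x y} → ¬ (x ≈ y) → x < y ⊎ y < x
  ≉⇒<⊎> {x} {y} x≉y with compare x y
  ... | tri< x<y _ _ = inj₁ x<y
  ... | tri≈ _ x≈y _ = contradiction x≈y x≉y
  ... | tri> _ _ y<x = inj₂ y<x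

  +-monoˡ-< : ∀ z {x y} → x < y → x + z < y + z
  +-monoˡ-< z x<y = <-respˡ-≈ (+-comm _ _) (<-respʳ-≈ (+-comm _ _) (+-monoʳ-< z x<y))

  +-monoˡ-≤ : ∀ z {x y} → x ≤ y → x + z ≤ y + z
  +-monoˡ-≤ z (inj₁ x<y) = inj₁ (+-monoˡ-< z x<y)
  +-monoˡ-≤ z (inj₂ x≈y) = inj₂ (+-congʳ x≈y)

  +-monoʳ-≤ : ∀ z {x y} → x ≤ y → z + x ≤ z + y
  +-monoʳ-≤ z (inj₁ x<y) = inj₁ (+-monoʳ-< z x<y)
  +-monoʳ-≤ z (inj₂ x≈y) = inj₂ (+-congˡ x≈y)

  +-mono-≤ : ∀ {x y z w} → x ≤ y → z ≤ w → x + z ≤ y + w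
  +-mono-≤ {y = y} {z} x≤y z≤w = ≤-trans (+-monoˡ-≤ z x≤y) (+-monoʳ-≤ y z≤w)

  x+z-z≈x : ∀ x z → (x + z) - z ≈ x
  x+z-z≈x x z = trans (+-assoc _ _ _) (trans (+-congˡ (-‿inverseʳ z)) (+-identityʳ x))

  x-z+z≈x : ∀ x z → (x - z) + z ≈ x
  x-z+z≈x x z = trans (+-assoc _ _ _) (trans (+-congˡ (-‿inverseˡ z)) (+-identityʳ x))

  +-cancelʳ-≈ : ∀ z {x y} → x + z ≈ y + z → x ≈ y
  +-cancelʳ-≈ z {x} {y} eq = trans (sym (x+z-z≈x x z)) (trans (+-congʳ eq) (x+z-z≈x y z))

  +-cancelʳ-< : ∀ z {x y} → x + z < y + z → x < y
  +-cancelʳ-< z {x} {y} lt =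
    <-respˡ-≈ (x+z-z≈x x z) (<-respʳ-≈ (x+z-z≈x y z) (+-monoˡ-< (- z) lt))

  +-cancelʳ-≤ : ∀ z {x y} → x + z ≤ y + z → x ≤ y
  +-cancelʳ-≤ z (inj₁ lt) = inj₁ (+-cancelʳ-< z lt)
  +-cancelʳ-≤ z (inj₂ eq) = inj₂ (+-cancelʳ-≈ z eq)

  x<x+y : ∀ x {y} → 0# < y → x < x + y
  x<x+y x 0<y = <-respˡ-≈ (+-identityʳ x) (+-monoʳ-< x 0<y)

  x≤x+y : ∀ x {y} → 0# ≤ y → x ≤ x + y
  x≤x+y x 0≤y = ≤-trans (≈⇒≤ (sym (+-identityʳ x))) (+-monoʳ-≤ x 0≤y)

  x<y⇒0<y-x : ∀ {x y} → x < y → 0# < y - x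
  x<y⇒0<y-x {x} x<y = <-respˡ-≈ (-‿inverseʳ x) (+-monoˡ-< (- x) x<y)

  z<y-x : ∀ {x y z} → x + z < y → z < y - x
  z<y-x {x} {y} {z} lt =
    +-cancelʳ-< x (<-respˡ-≈ (+-comm x z) (<-respʳ-≈ (sym (x-z+z≈x y x)) lt))

  *-mono-< : ∀ {x y} → 0# < x → x < y → x * x < y * y
  *-mono-< {x} {y} 0<x x<y = begin-strict
    x * x            <⟨ x<x+y _ (*-pos 0<x 0<d) ⟩
    x * x + x * d    ≈⟨ distribˡ x x d ⟨
    x * (x + d)      ≈⟨ *-congˡ x+d≈y ⟩
    x * y            <⟨ x<x+y _ (*-pos 0<d (<-trans 0<x x<y)) ⟩
    x * y + d * y    ≈⟨ distribʳ y x d ⟨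
    (x + d) * y      ≈⟨ *-congʳ x+d≈y ⟩
    y * y            ∎
    where
    open ≤-Reasoning
    d = y - x
    0<d = x<y⇒0<y-x x<y
    x+d≈y : x + d ≈ y
    x+d≈y = trans (+-comm x d) (x-z+z≈x y x)

  -x*-y≈x*y : ∀ x y → (- x) * (- y) ≈ x * y
  -x*-y≈x*y x y = trans (sym (-‿distribˡ-* x (- y)))
    (trans (-‿cong (sym (-‿distribʳ-* x y))) (-‿involutive (x * y)))

  -[x-y]≈y-x : ∀ x y → - (x - y) ≈ y - x
  -[x-y]≈y-x x y = +-cancelʳ-≈ (x - y)
    (trans (-‿inverseˡ _) (sym (trans (sym (+-assoc _ _ _)) (trans (+-congʳ (x-z+z≈x y x)) (-‿inverseʳ y)))))

  [x-y]²≈[y-x]² : ∀ x y → (x - y) * (x - y) ≈ (y - x) * (y - x)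
  [x-y]²≈[y-x]² x y =
    trans (sym (-x*-y≈x*y _ _)) (*-cong (-[x-y]≈y-x x y) (-[x-y]≈y-x x y))

  0≤x² : ∀ x → 0# ≤ x * x
  0≤x² x with compare x 0#
  ... | tri> _ _ 0<x = inj₁ (*-pos 0<x 0<x)
  ... | tri≈ _ x≈0 _ = inj₂ (sym (trans (*-congʳ x≈0) (zeroˡ x)))
  ... | tri< x<0 _ _ = inj₁ (<-respʳ-≈ (-x*-y≈x*y x x) (*-pos 0<-x 0<-x))
    where
    0<-x : 0# < - x
    0<-x = <-respʳ-≈ (+-identityˡ _) (x<y⇒0<y-x x<0)

  -- If `x` exceeded `y + r`, then `x - y` would exceed the positive `r`, and so would its square.
  -- Distances can thus be compared without roots or absolute values.
  x≤y+r : ∀ {x y r} → 0# < r → (x - y) * (x - y) ≤ r * r → x ≤ y + r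
  x≤y+r 0<r sq≤ = ≮⇒≥ λ y+r<x → <⇒≱ (*-mono-< 0<r (z<y-x y+r<x)) sq≤

  y≤x+r : ∀ {x y r} → 0# < r → (x - y) * (x - y) ≤ r * r → y ≤ x + r
  y≤x+r {x} {y} 0<r sq≤ = x≤y+r 0<r (≤-trans (≈⇒≤ ([x-y]²≈[y-x]² y x)) sq≤)

  0<2 : 0# < 1# + 1#
  0<2 = <-trans 0<1 (x<x+y 1# 0<1)

  half : ∀ {x} → 0# < x → ∃[ h ] 0# < h × h + h ≈ x
  half {x} 0<x = x * h , 0<x*h , x*h+x*h≈x
    where
    h = proj₁ (inverse (1# + 1#) (λ 2≈0 → <-irrefl (sym 2≈0) 0<2))
    2h≈1 = proj₂ (inverse (1# + 1#) (λ 2≈0 → <-irrefl (sym 2≈0) 0<2))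
    x*h+x*h≈x : x * h + x * h ≈ x
    x*h+x*h≈x = begin-equality
      x * h + x * h               ≈⟨ distribˡ x h h ⟨
      x * (h + h)                 ≈⟨ *-congˡ (+-cong (*-identityˡ h) (*-identityˡ h)) ⟨
      x * (1# * h + 1# * h)       ≈⟨ *-congˡ (distribʳ h 1# 1#) ⟨
      x * ((1# + 1#) * h)         ≈⟨ *-congˡ 2h≈1 ⟩
      x * 1#                      ≈⟨ *-identityʳ x ⟩
      x                           ∎
      where open ≤-Reasoning
    0<x*h : 0# < x * h
    0<x*h with <-or-≥ 0# (x * h)
    ... | inj₁ lt = lt
    ... | inj₂ ge = contradiction
      (≤-trans (≈⇒≤ (sym x*h+x*h≈x)) (≤-trans (+-mono-≤ ge ge) (≈⇒≤ (+-identityʳ 0#)))) (<⇒≱ 0<x)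

  -- Whether P holds can be read off the supremum of {0} ∪ {1 ∣ P}.
  abstract
    excludedMiddle : (P : Set) → Dec P
    excludedMiddle P with supremum S (0# , inj₁ refl) (1# , bounded)
      where
      S : Carrier → Set
      S x = x ≈ 0# ⊎ (x ≈ 1# × P)
      bounded : ∀ {x} → S x → x ≤ 1#
      bounded (inj₁ x≈0)       = inj₁ (<-respˡ-≈ (sym x≈0) 0<1)
      bounded (inj₂ (x≈1 , _)) = inj₂ x≈1
    ... | s , upper , approached with <-or-≥ s 1#
    ... | inj₁ s<1 = no λ p → <⇒≱ s<1 (upper (inj₂ (refl , p)))
    ... | inj₂ 1≤s with approached (<-≤-trans 0<1 1≤s)
    ... | x , inj₁ x≈0 , 0<x     = contradiction 0<x (<-irrefl (sym x≈0))
    ... | x , inj₂ (_ , p) , 0<x = yes p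

  -- Validity near 0 on the positive side. It survives finite conjunctions, so one number can be
  -- made small enough for finitely many strict inequalities at once.
  Eventually : (Carrier → Set) → Set
  Eventually P = ∃[ r ] 0# < r × (∀ {s} → 0# < s → s ≤ r → P s)

  eventually-× : ∀ {P Q} → Eventually P → Eventually Q → Eventually (λ s → P s × Q s)
  eventually-× (r , 0<r , p) (r′ , 0<r′ , q) with ≤-total r r′
  ... | inj₁ r≤r′ = r , 0<r , λ 0<s s≤r → p 0<s s≤r , q 0<s (≤-trans s≤r r≤r′)
  ... | inj₂ r′≤r = r′ , 0<r′ , λ 0<s s≤r → p 0<s (≤-trans s≤r r′≤r) , q 0<s s≤r

  eventually-∀ : ∀ {n} {P : Fin n → Carrier → Set} →
                 (∀ e → Eventually (P e)) → Eventually (λ s → ∀ e → P e s)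
  eventually-∀ {ℕ.zero} _ = 1# , 0<1 , λ _ _ ()
  eventually-∀ {ℕ.suc n} ev with eventually-× (ev zero) (eventually-∀ (ev ∘ suc))
  ... | r , 0<r , p = r , 0<r , λ 0<s s≤r → λ { zero → proj₁ (p 0<s s≤r) ; (suc e) → proj₂ (p 0<s s≤r) e }

  -- A margin can be chosen only for inequalities that hold. Excluded middle decides which ones do;
  -- for the others any threshold works, here 1.
  eventually-→ : ∀ {A : Set} {P : Carrier → Set} → (A → Eventually P) → Eventually (λ s → A → P s)
  eventually-→ {A} ev with excludedMiddle A
  ... | yes a = let r , 0<r , p = ev a in r , 0<r , λ 0<s s≤r _ → p 0<s s≤r
  ... | no ¬a = 1# , 0<1 , λ _ _ a → contradiction a ¬a

  eventually-< : ∀ {x y} → x < y → Eventually (λ s → x + s < y)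
  -- Half the gap, so that the inequality is still strict at the threshold itself.
  eventually-< {x} {y} x<y with half (x<y⇒0<y-x x<y)
  ... | h , 0<h , h+h≈y-x = h , 0<h , λ {s} 0<s s≤h → begin-strict
    x + s        ≤⟨ +-monoʳ-≤ x s≤h ⟩
    x + h        <⟨ +-monoʳ-< x (x<x+y h 0<h) ⟩
    x + (h + h)  ≈⟨ +-congˡ h+h≈y-x ⟩
    x + (y - x)  ≈⟨ +-comm _ _ ⟩
    (y - x) + x  ≈⟨ x-z+z≈x y x ⟩
    y            ∎
    where open ≤-Reasoning

  upperBound : ∀ {n} (f : Fin n → Carrier) → ∃[ M ] 0# < M × (∀ e → f e ≤ M)
  upperBound {ℕ.zero} f = 1# , 0<1 , λ ()
  upperBound {ℕ.suc n} f with upperBound (f ∘ suc)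
  ... | M , 0<M , f≤M with ≤-total (f zero) M
  ... | inj₁ f₀≤M = M , 0<M , λ { zero → f₀≤M ; (suc e) → f≤M e }
  ... | inj₂ M≤f₀ = f zero , <-≤-trans 0<M M≤f₀ , λ { zero → ≤-refl ; (suc e) → ≤-trans (f≤M e) M≤f₀ }

-- Walks, bridges and edge colourings in acyclic graphs.

module _ {k : ℕ} where

  Avoiding : Rel (Fin k) 0ℓ → Fin k → Rel (Fin k) 0ℓ
  Avoiding R x a b = R a b × a ≢ x × b ≢ x

  -- A path from x to z that visits x ∷ vs in this order.
  data SimplePath (R : Rel (Fin k) 0ℓ) : Fin k → List (Fin k) → Fin k → Set where
    []   : ∀ {x} → SimplePath R x [] x
    cons : ∀ {x y z vs} → R x y → x ∉ᴸ y ∷ vs → SimplePath R y vs z → SimplePath R x (y ∷ vs) z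

  module _ {R : Rel (Fin k) 0ℓ} where

    suffix : ∀ {x y z vs} → SimplePath R y vs z → x ∈ᴸ y ∷ vs → ∃[ us ] SimplePath R x us z
    suffix p            (here ≡.refl) = _ , p
    suffix (cons _ _ p) (there x∈vs)  = suffix p x∈vs

    -- Induction on the walk: if the new first vertex recurs on the path found so far, the suffix
    -- starting at that recurrence is kept instead.
    loopErase : ∀ {x z} → Star R x z → ∃[ vs ] SimplePath R x vs z
    loopErase ε = [] , []
    loopErase {x} (_◅_ {j = y} r rs) with loopErase rs
    ... | vs , p with member? _≟_ x (y ∷ vs)
    ... | yes x∈ = suffix p x∈
    ... | no x∉  = y ∷ vs , cons r x∉ p

    unique : ∀ {x vs z} → SimplePath R x vs z → Unique (x ∷ vs)
    unique []            = [] ∷ []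
    unique (cons _ x∉ p) = ¬Any⇒All¬ _ x∉ ∷ unique p

    linked : ∀ {x vs z w} → SimplePath R x vs z → R z w → Linked R (x ∷ vs ++ [ w ])
    linked []           s = s ∷ [-]
    linked (cons r _ p) s = r ∷ linked p s

    avoiding : ∀ {x y vs z} → SimplePath R y vs z → x ∉ᴸ y ∷ vs → Star (Avoiding R x) y z
    avoiding []           x∉ = ε
    avoiding (cons r _ p) x∉ =
      (r , (λ y≡x → x∉ (here (≡.sym y≡x))) , (λ w≡x → x∉ (there (here (≡.sym w≡x))))) ◅ avoiding p (x∉ ∘ there)

  module _ {G : Graph k} (acyclic : IsAcyclic G) where

    Without : Fin k → Fin k → Rel (Fin k) 0ℓ
    Without x y a b = Adj G a b × ¬ (a ≡ x × b ≡ y) × ¬ (a ≡ y × b ≡ x)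

    Without-sym : ∀ {x y} → Symmetric (Without x y)
    Without-sym (a~b , ≢₁ , ≢₂) =
      Adj-sym G a~b , (λ (p , q) → ≢₂ (q , p)) , (λ (p , q) → ≢₁ (q , p))

    -- A simple path from `x` to `y` is either a single edge, which would be the deleted one, or has
    -- at least three vertices and is closed into a cycle by `xy`.
    bridge : ∀ {x y} → Adj G x y → ¬ Star (Without x y) x y
    bridge {x} {y} x~y walk with loopErase walk
    ... | _ , []                         = Adj-irrefl G x~y
    ... | _ , cons (_ , ≢ , _) _ []      = ≢ (≡.refl , ≡.refl)
    ... | vs , p@(cons _ _ (cons _ _ _)) = acyclic x vs record
      { length≥3 = s≤s (s≤s (s≤s z≤n))
      ; distinct = unique p
      ; closed   = linked (weaken p) (Adj-sym G x~y)
      }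
      where
      weaken : ∀ {a us b} → SimplePath (Without x y) a us b → SimplePath (Adj G) a us b
      weaken []             = []
      weaken (cons r a∉ p)  = cons (proj₁ r) a∉ (weaken p)

    module Coloured {n : ℕ} {E : Fin n → Rel (Fin k) 0ℓ}
      (E⇒Adj : ∀ {i u v} → E i u v → Adj G u v)
      (E-sym : ∀ {i u v} → E i u v → E i v u)
      (E-unique : ∀ {i j u v} → E i u v → E j u v → i ≡ j)
      (Adj⇒E : ∀ {u v} → Adj G u v → ∃[ i ] E i u v)
      where

      Other : Fin n → Rel (Fin k) 0ℓ
      Other i u v = ∃[ j ] j ≢ i × E j u v

      Other-sym : ∀ {i} → Symmetric (Other i)
      Other-sym (j , j≢i , e) = j , j≢i , E-sym e

      -- Contracting the blobs of colour i leaves a tree whose edges are those of colour i.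
      Blob : Fin n → Rel (Fin k) 0ℓ
      Blob i = Star (Other i)

      Blob-sym : ∀ {i} → Symmetric (Blob i)
      Blob-sym = Star.reverse Other-sym

      Blob-isEquivalence : ∀ {i} → IsEquivalence (Blob i)
      Blob-isEquivalence = record { refl = ε ; sym = Blob-sym ; trans = _◅◅_ }

      -- The walk from `x` to `z` misses the edge `xy` because its colours differ from `j`, the walk
      -- from `y` to `z` misses it because it avoids `x`. Together they would bypass a bridge.
      detour : ∀ {j x y z} → E j x y → Star (Avoiding (Adj G) x) y z → ¬ Blob j x z
      detour {j} {x} {y} e y⇝z x⇝z = bridge (E⇒Adj e)
        (Star.map other x⇝z ◅◅ Star.reverse Without-sym (Star.map away y⇝z))
        where
        other : ∀ {a b} → Other j a b → Without x y a b
        other (j′ , j′≢j , e′) = E⇒Adj e′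
          , (λ { (≡.refl , ≡.refl) → j′≢j (E-unique e′ e) })
          , (λ { (≡.refl , ≡.refl) → j′≢j (E-unique e′ (E-sym e)) })
        away : ∀ {a b} → Avoiding (Adj G) x a b → Without x y a b
        away (a~b , a≢x , b≢x) = a~b , (λ (a≡x , _) → a≢x a≡x) , (λ (_ , b≡x) → b≢x b≡x)

      -- After loop erasure the first edge of the path has colour `i`, and the rest avoids `x`, so
      -- `detour` applies.
      monochromatic⇒¬Blob : ∀ {i x z} → x ≢ z → Star (E i) x z → ¬ Blob i x z
      monochromatic⇒¬Blob x≢z walk with loopErase walk
      ... | _ , []           = contradiction ≡.refl x≢z
      ... | _ , cons e x∉ p = detour e (Star.map (λ (e , ≢) → E⇒Adj e , ≢) (avoiding p x∉))

      -- The colour `j` is that of the first edge on a simple path whose colour is not `i`. By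
      -- `detour` that edge separates its start from `z`; the edges of colour `i` before it stay
      -- inside blobs of `j`, so the separation carries back to `x`.
      ¬monochromatic⇒¬Blob : ∀ {i x z} → Star (Adj G) x z → ¬ Star (E i) x z →
                             ∃[ j ] j ≢ i × ¬ Blob j x z
      ¬monochromatic⇒¬Blob {i} walk = go (proj₂ (loopErase walk))
        where
        go : ∀ {x vs z} → SimplePath (Adj G) x vs z → ¬ Star (E i) x z → ∃[ j ] j ≢ i × ¬ Blob j x z
        go []              ¬mono = contradiction ε ¬mono
        go (cons x~y x∉ p) ¬mono with Adj⇒E x~y
        ... | j , e with j ≟ i
        ... | no j≢i    = j , j≢i , detour e (avoiding p x∉)
        ... | yes ≡.refl with go p (λ mono → ¬mono (e ◅ mono))
        ... | j′ , j′≢j , ¬blob =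
          j′ , j′≢j , λ blob → ¬blob ((j , j′≢j ∘ ≡.sym , E-sym e) ◅ blob)

  reachable∈V : (G : Graph k) → ∀ {u v} → u ∈ V G → Star (Adj G) u v → v ∈ V G
  reachable∈V G u∈V ε          = u∈V
  reachable∈V G u∈V (r ◅ rs) = reachable∈V G (Adj⇒V G (Adj-sym G r)) rs

  Component : Graph k → Fin k → Graph k
  Component G x = record
    { V          = λ v → v ∈ V G × Star (Adj G) x v
    ; Adj        = λ u v → Adj G u v × Star (Adj G) x u
    ; Adj⇒V      = λ (u~v , x⇝u) → Adj⇒V G u~v , x⇝u
    ; Adj-sym    = λ (u~v , x⇝u) → Adj-sym G u~v , x⇝u ◅◅ u~v ◅ ε
    ; Adj-irrefl = Adj-irrefl G ∘ proj₁
    }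

  Component-isTree : (G : Graph k) → IsAcyclic G → ∀ {x} → x ∈ V G → IsTree (Component G x)
  Component-isTree G acyclic {x} x∈V =
    ((x , x∈V , ε) , λ (_ , x⇝u) (_ , x⇝v) → connect x⇝u (Star.reverse (Adj-sym G) x⇝u ◅◅ x⇝v))
    , λ v vs c → let open IsCycle c in
        acyclic v vs (record { length≥3 = length≥3 ; distinct = distinct ; closed = Linked.map proj₁ closed })
    where
    connect : ∀ {u v} → Star (Adj G) x u → Star (Adj G) u v → Star (Adj (Component G x)) u v
    connect x⇝u ε          = ε
    connect x⇝u (r ◅ rs) = (r , x⇝u) ◅ connect (x⇝u ◅◅ r ◅ ε) rs

lookup-injective : ∀ {A : Set} {xs : List A} → Unique xs → ∀ i j → lookup xs i ≡ lookup xs j → i ≡ j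
lookup-injective (x∉ ∷ u) zero    zero    eq = ≡.refl
lookup-injective (x∉ ∷ u) zero    (suc j) eq = contradiction eq (All.lookup x∉ (∈-lookup j))
lookup-injective (x∉ ∷ u) (suc i) zero    eq = contradiction (≡.sym eq) (All.lookup x∉ (∈-lookup i))
lookup-injective (x∉ ∷ u) (suc i) (suc j) eq = ≡.cong suc (lookup-injective u i j eq)

-- Minimal elements and connected components.

module Classical (excludedMiddle : (P : Set) → Dec P) where

  minimal : ∀ {A : Set} {_⊏_ : Rel A 0ℓ} → WellFounded _⊏_ → {P : Pred A 0ℓ} → ∀ {x} → P x →
            ∃[ y ] P y × (∀ {z} → P z → ¬ z ⊏ y)
  minimal {_⊏_ = _⊏_} wf {P} {x} = go (wf x)
    where
    go : ∀ {x} → Acc _⊏_ x → P x → ∃[ y ] P y × (∀ {z} → P z → ¬ z ⊏ y)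
    go {x} (acc rs) px with excludedMiddle (∃[ z ] P z × z ⊏ x)
    ... | yes (z , pz , z⊏x) = go (rs z⊏x) pz
    ... | no ¬∃              = x , px , λ pz z⊏x → ¬∃ (_ , pz , z⊏x)

  module _ {k : ℕ} where

    least : {P : Pred (Fin k) 0ℓ} → ∀ {x} → P x → ∃[ y ] P y × (∀ {z} → P z → ¬ z <ᶠ y)
    least = minimal <ᶠ-wellFounded

    -- Each component is represented by its least vertex. Two representatives with a common
    -- reachable vertex reach each other, so neither is less than the other.
    components : (G : Graph k) → ∃[ l ] Σ[ x ∈ (Fin l → Fin k) ]
      (∀ c → x c ∈ V G) × G IsUnionOf (λ c → Component G (x c)) ×
      (∀ {c d} → c ≢ d → V (Component G (x c)) ⊥ V (Component G (x d)))
    components G = length reps , lookup reps , (λ c → proj₁ (rep c)) , union , disjoint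
      where
      IsRep : Pred (Fin k) 0ℓ
      IsRep x = x ∈ V G × (∀ {y} → Star (Adj G) x y → ¬ y <ᶠ x)
      reps = filter (λ x → excludedMiddle (IsRep x)) (allFin k)
      rep : ∀ c → IsRep (lookup reps c)
      rep c = proj₂ (∈-filter⁻ (λ x → excludedMiddle (IsRep x)) {xs = allFin k} (∈-lookup c))
      find : ∀ {v} → v ∈ V G → ∃[ c ] Star (Adj G) (lookup reps c) v
      find {v} v∈V with least {P = Star (Adj G) v} ε
      ... | x , v⇝x , x-least = index x∈reps
        , ≡.subst (λ y → Star (Adj G) y v) (lookup-index x∈reps) (Star.reverse (Adj-sym G) v⇝x)
        where
        x∈reps : x ∈ᴸ reps
        x∈reps = ∈-filter⁺ (λ x → excludedMiddle (IsRep x)) (∈-allFin x)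
          (reachable∈V G v∈V v⇝x , λ x⇝y → x-least (v⇝x ◅◅ x⇝y))
      union : G IsUnionOf (λ c → Component G (lookup reps c))
      union = record
        { subgraph  = λ c → record { V-⊆ = proj₁ ; Adj-⊆ = proj₁ }
        ; V-cover   = λ v∈V → let c , x⇝v = find v∈V in c , v∈V , x⇝v
        ; Adj-cover = λ u~v → let c , x⇝u = find (Adj⇒V G u~v) in c , u~v , x⇝u
        }
      disjoint : ∀ {c d} → c ≢ d →
                 V (Component G (lookup reps c)) ⊥ V (Component G (lookup reps d))
      disjoint {c} {d} c≢d ((_ , x⇝v) , (_ , y⇝v)) with <ᶠ-cmp (lookup reps c) (lookup reps d)
      ... | tri< x<y _ _ = proj₂ (rep d) (y⇝v ◅◅ Star.reverse (Adj-sym G) x⇝v) x<y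
      ... | tri≈ _ x≡y _ = c≢d (lookup-injective (filter⁺ _ (allFin⁺ k)) c d x≡y)
      ... | tri> _ _ y<x = proj₂ (rep c) (x⇝v ◅◅ Star.reverse (Adj-sym G) y⇝v) y<x

-- Lines parallel to an axis, and visibility along a single line.

module Geometry (ℝ : CompleteOrderedField) where
  open OrderedField ℝ
  open Visibility ℝ
  open Classical excludedMiddle
  open Sum +-commutativeMonoid using (sum; sum-cong-≋; sum-replicate-zero)

  sum-zero : ∀ {n} {t : Vector Carrier n} → (∀ j → t j ≈ 0#) → sum t ≈ 0#
  sum-zero {n} t≈0 = trans (sum-cong-≋ t≈0) (sum-replicate-zero n)

  sum-single : ∀ {n} {t : Vector Carrier n} j → (∀ {l} → l ≢ j → t l ≈ 0#) → sum t ≈ t j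
  sum-single {t = t} zero    t≈0 = trans (+-congˡ (sum-zero {t = t ∘ suc} λ l → t≈0 λ ())) (+-identityʳ _)
  sum-single (suc j) t≈0 =
    trans (+-cong (t≈0 λ ()) (sum-single j λ l≢j → t≈0 λ { ≡.refl → l≢j ≡.refl })) (+-identityˡ _)

  sum-nonneg : ∀ {n} {t : Vector Carrier n} → (∀ j → 0# ≤ t j) → 0# ≤ sum t
  sum-nonneg {ℕ.zero}  _   = ≤-refl
  sum-nonneg {ℕ.suc n} 0≤t =
    ≤-trans (≈⇒≤ (sym (+-identityʳ 0#))) (+-mono-≤ (0≤t zero) (sum-nonneg (0≤t ∘ suc)))

  term≤sum : ∀ {n} {t : Vector Carrier n} → (∀ j → 0# ≤ t j) → ∀ j → t j ≤ sum t
  term≤sum 0≤t zero    = x≤x+y _ (sum-nonneg (0≤t ∘ suc))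
  term≤sum 0≤t (suc j) = ≤-trans (term≤sum (0≤t ∘ suc) j)
    (≤-trans (x≤x+y _ (0≤t zero)) (≈⇒≤ (+-comm _ _)))

  module _ {d : ℕ} where

    infixl 6 _[_≔_]

    _[_≔_] : Point d → Fin d → Carrier → Point d
    p [ i ≔ t ] = updateAt p i (const t)

    ≔-updates : ∀ (p : Point d) i {t} → (p [ i ≔ t ]) i ≈ t
    ≔-updates p i = ≡⇒≈ (updateAt-updates i p)

    ≔-minimal : ∀ (p : Point d) {i j t} → j ≢ i → (p [ i ≔ t ]) j ≈ p j
    ≔-minimal p j≢i = ≡⇒≈ (updateAt-minimal _ _ p j≢i)

    module _ (i : Fin d) (p x : Point d) where

      squares : Vector Carrier d
      squares j = (x j - p j) * (x j - p j)

      terms : Vector Carrier d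
      terms = updateAt squares i (const 0#)

      term-other : ∀ {j} → j ≢ i → terms j ≈ squares j
      term-other j≢i = ≡⇒≈ (updateAt-minimal _ i squares j≢i)

      term-zero : ∀ {j} → (j ≢ i → x j ≈ p j) → terms j ≈ 0#
      term-zero {j} x≈p with j ≟ i
      ... | yes ≡.refl = ≡⇒≈ (updateAt-updates i squares)
      ... | no j≢i = trans (term-other j≢i)
        (trans (*-congʳ (trans (+-congʳ (x≈p j≢i)) (-‿inverseʳ _))) (zeroˡ _))

      square≤dist : ∀ {j} → j ≢ i → squares j ≤ distToAxis² i p x
      square≤dist {j} j≢i = ≤-trans (≈⇒≤ (sym (term-other j≢i))) (term≤sum 0≤terms j)
        where
        0≤terms : ∀ l → 0# ≤ terms l
        0≤terms l with l ≟ i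
        ... | yes ≡.refl = ≈⇒≤ (sym (≡⇒≈ (updateAt-updates i squares)))
        ... | no l≢i     = ≤-trans (0≤x² _) (≈⇒≤ (sym (term-other l≢i)))

    -- The `i`-th coordinate is ignored: the line through `p` parallel to the `i`-th axis passes
    -- through the interior of the cross-section at `a`, respectively meets the closed
    -- cross-section.
    OpenCovers Covers : Fin d → Point d → Point d → Set
    OpenCovers i a p = ∀ {j} → j ≢ i → a j < p j × p j < a j + 1#
    Covers     i a p = ∀ {j} → j ≢ i → a j ≤ p j × p j ≤ a j + 1#

    open⇒covers : ∀ {i a p} → OpenCovers i a p → Covers i a p
    open⇒covers cov j≢i = let l , r = cov j≢i in <⇒≤ l , <⇒≤ r

    module _ {i : Fin d} (C : Cylinder i) where
      open Cylinder C

      axis : Carrier → Point d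
      axis t = centre [ i ≔ t ]

      axis-near : ∀ t → distToAxis² i centre (axis t) ≤ radius * radius
      axis-near t = ≤-trans
        (≈⇒≤ (sum-zero {t = terms i centre (axis t)} λ j → term-zero i centre (axis t) (≔-minimal centre)))
        (0≤x² radius)

      axis∈Solid : ∀ {t} → start ≤ t → t ≤ end → axis t ∈ Solid
      axis∈Solid {t} s≤t t≤e =
        (≤-trans s≤t (≈⇒≤ (sym (≔-updates centre i))) , ≤-trans (≈⇒≤ (≔-updates centre i)) t≤e)
        , axis-near t

      axis∈Base : ∀ t → axis t ∈ Base t
      axis∈Base t = ≔-updates centre i , axis-near t

      -- At such a point only the `j`-th summand of the squared distance survives, and it equals the
      -- squared radius.
      rim∈Base : ∀ t {j y} → j ≢ i → (y - centre j) * (y - centre j) ≈ radius * radius →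
                 axis t [ j ≔ y ] ∈ Base t
      rim∈Base t {j} {y} j≢i sq≈ =
        trans (≔-minimal (axis t) (j≢i ∘ ≡.sym)) (≔-updates centre i)
        , ≈⇒≤ (trans (sum-single j λ {l} l≢j → term-zero i centre x λ l≢i →
                        trans (≔-minimal (axis t) l≢j) (≔-minimal centre l≢i))
               (trans (term-other i centre x j≢i)
               (trans (*-cong (+-congʳ (≔-updates (axis t) j)) (+-congʳ (≔-updates (axis t) j))) sq≈)))
        where x = axis t [ j ≔ y ]

      -- For each lateral direction `j` the two rim points at `centre j` plus and minus `radius` are
      -- covered; as the radius is positive, the centre lies strictly between the faces.
      base⇒openCovers : ∀ {a t} → (∀ {x} → x ∈ Base t → Covers i a x) → OpenCovers i a centre
      base⇒openCovers {a} {t} covers {j} j≢i = a<c , c<a+1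
        where
        c+r-c≈r : (centre j + radius) - centre j ≈ radius
        c+r-c≈r = trans (+-congʳ (+-comm _ _)) (x+z-z≈x radius (centre j))
        high = proj₂ (covers (rim∈Base t j≢i (*-cong c+r-c≈r c+r-c≈r)) j≢i)
        c<a+1 = <-≤-trans (x<x+y (centre j) radius>0)
          (≤-trans (≈⇒≤ (sym (≔-updates (axis t) j))) high)
        c-r-c≈-r : (centre j - radius) - centre j ≈ - radius
        c-r-c≈-r = trans (+-congʳ (+-comm _ _)) (x+z-z≈x (- radius) (centre j))
        low = proj₁ (covers (rim∈Base t j≢i
          (trans (*-cong c-r-c≈-r c-r-c≈-r) (-x*-y≈x*y radius radius))) j≢i)
        a<c = ≤-<-trans (≤-trans low (≈⇒≤ (≔-updates (axis t) j)))
          (<-respʳ-≈ (x-z+z≈x (centre j) radius) (x<x+y (centre j - radius) radius>0))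

  Between : Carrier → Carrier → Carrier → Set
  Between x y z = (x ≤ y × y ≤ z) ⊎ (z ≤ y × y ≤ x)

  module _ {k d : ℕ} where

    -- u and v see each other along the line through p parallel to the i-th axis.
    record SeesAt (a : Fin k → Point d) (i : Fin d) (W : Pred (Fin k) 0ℓ)
                  (u v : Fin k) (p : Point d) : Set where
      field
        coversˡ : OpenCovers i (a u) p
        coversʳ : OpenCovers i (a v) p
        apart   : ¬ (a u i ≈ a v i)
        clear   : ∀ {w} → w ∈ W → w ≢ u → w ≢ v → Covers i (a w) p →
                  ¬ Between (a u i) (a w i) (a v i)

    Sees : (Fin k → Point d) → Fin d → Pred (Fin k) 0ℓ → Fin k → Fin k → Set
    Sees a i W u v = ∃[ p ] SeesAt a i W u v p

    module _ {a : Fin k → Point d} {i : Fin d} {W : Pred (Fin k) 0ℓ} where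

      SeesAt-sym : ∀ {u v p} → SeesAt a i W u v p → SeesAt a i W v u p
      SeesAt-sym s = record
        { coversˡ = coversʳ ; coversʳ = coversˡ ; apart = apart ∘ sym
        ; clear   = λ w∈W w≢v w≢u cov → clear w∈W w≢u w≢v cov ∘ swap
        } where open SeesAt s

      Sees-sym : ∀ {u v} → Sees a i W u v → Sees a i W v u
      Sees-sym (p , s) = p , SeesAt-sym s

      Sees-⊆ : ∀ {W′ u v} → W′ ⊆ W → Sees a i W u v → Sees a i W′ u v
      Sees-⊆ W′⊆W (p , s) = p , record
        { coversˡ = coversˡ ; coversʳ = coversʳ ; apart = apart ; clear = clear ∘ W′⊆W }
        where open SeesAt s

    -- Only the lateral coordinates are translated. The `i`-th coordinates of `a` and `a′` need not
    -- be related by a shift; their order is dealt with by the hypotheses of `SeesAt-shift`.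
    module Translation {a a′ : Fin k → Point d} {i : Fin d} {W : Pred (Fin k) 0ℓ}
             (t : Point d) (shift : ∀ {w j} → w ∈ W → j ≢ i → a′ w j ≈ a w j + t j) where

      shifted : Point d → Point d
      shifted p j = p j + t j

      private
        +1-shift : ∀ {w j} → w ∈ W → j ≢ i → a′ w j + 1# ≈ (a w j + 1#) + t j
        +1-shift w∈W j≢i = trans (+-congʳ (shift w∈W j≢i))
          (trans (+-assoc _ _ _) (trans (+-congˡ (+-comm _ _)) (sym (+-assoc _ _ _))))

      openCovers-shift : ∀ {w p} → w ∈ W → OpenCovers i (a w) p → OpenCovers i (a′ w) (shifted p)
      openCovers-shift w∈W cov {j} j≢i =
        <-respˡ-≈ (sym (shift w∈W j≢i)) (+-monoˡ-< (t j) (proj₁ (cov j≢i)))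
        , <-respʳ-≈ (sym (+1-shift w∈W j≢i)) (+-monoˡ-< (t j) (proj₂ (cov j≢i)))

      covers-shift : ∀ {w p} → w ∈ W → Covers i (a w) p → Covers i (a′ w) (shifted p)
      covers-shift w∈W cov {j} j≢i =
        ≤-trans (≈⇒≤ (shift w∈W j≢i)) (+-monoˡ-≤ (t j) (proj₁ (cov j≢i)))
        , ≤-trans (+-monoˡ-≤ (t j) (proj₂ (cov j≢i))) (≈⇒≤ (sym (+1-shift w∈W j≢i)))

      covers-unshift : ∀ {w p} → w ∈ W → Covers i (a′ w) (shifted p) → Covers i (a w) p
      covers-unshift w∈W cov {j} j≢i =
        +-cancelʳ-≤ (t j) (≤-trans (≈⇒≤ (sym (shift w∈W j≢i))) (proj₁ (cov j≢i)))
        , +-cancelʳ-≤ (t j) (≤-trans (proj₂ (cov j≢i)) (≈⇒≤ (+1-shift w∈W j≢i)))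

      -- Comparison of orders is demanded only for objects on the line. When it is applied to pass
      -- from cubes to panels, ties in height can be excluded only there.
      SeesAt-shift : ∀ {u v p} → u ∈ W → v ∈ W → ¬ (a′ u i ≈ a′ v i) →
        (∀ {w} → w ∈ W → w ≢ u → w ≢ v → Covers i (a w) p →
           Between (a′ u i) (a′ w i) (a′ v i) → Between (a u i) (a w i) (a v i)) →
        SeesAt a i W u v p → SeesAt a′ i W u v (shifted p)
      SeesAt-shift u∈W v∈W apart′ between s = record
        { coversˡ = openCovers-shift u∈W coversˡ
        ; coversʳ = openCovers-shift v∈W coversʳ
        ; apart   = apart′
        ; clear   = λ w∈W w≢u w≢v cov btw →
            let cov′ = covers-unshift w∈W cov in
            clear w∈W w≢u w≢v cov′ (between w∈W w≢u w≢v cov′ btw)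
        } where open SeesAt s

    Sees-cong : ∀ {a a′ : Fin k → Point d} {i W} → (∀ {w} → w ∈ W → ∀ j → a′ w j ≡ a w j) →
                ∀ {u v} → u ∈ W → v ∈ W → Sees a i W u v → Sees a′ i W u v
    Sees-cong {a} {a′} {i} {W} eq {u} {v} u∈W v∈W (p , s) =
      _ , Translation.SeesAt-shift (const 0#) (λ {w} {j} w∈W _ → trans (≡⇒≈ (eq w∈W j)) (sym (+-identityʳ _))) u∈W v∈W
        (λ u≈v → SeesAt.apart s (≡.subst₂ _≈_ (eq u∈W i) (eq v∈W i) u≈v))
        (λ w∈W _ _ _ → [ inj₁ ∘ (λ (p , q) → ≤-resp u∈W w∈W p , ≤-resp w∈W v∈W q)
                       , inj₂ ∘ (λ (p , q) → ≤-resp v∈W w∈W p , ≤-resp w∈W u∈W q) ]′)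
        s
      where
      ≤-resp : ∀ {x y} → x ∈ W → y ∈ W → a′ x i ≤ a′ y i → a x i ≤ a y i
      ≤-resp x∈W y∈W = ≡.subst₂ _≤_ (eq x∈W i) (eq y∈W i)

    Sees-permute : ∀ {a : Fin k → Point d} {i i′ W} (σ τ : Fin d → Fin d) →
                   (∀ j → σ (τ j) ≡ j) → (∀ j → τ (σ j) ≡ j) → σ i′ ≡ i →
                   ∀ {u v} → Sees a i W u v → Sees (λ w → a w ∘ σ) i′ W u v
    Sees-permute {a} {i′ = i′} σ τ στ τσ ≡.refl (p , s) = p ∘ σ , record
      { coversˡ = λ j≢ → coversˡ (σ≢ j≢)
      ; coversʳ = λ j≢ → coversʳ (σ≢ j≢)
      ; apart   = apart
      ; clear   = λ {w} w∈W w≢u w≢v cov → clear w∈W w≢u w≢v (unpermute w cov)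
      }
      where
      open SeesAt s
      σ≢ : ∀ {j} → j ≢ i′ → σ j ≢ σ i′
      σ≢ j≢ eq = j≢ (≡.trans (≡.sym (τσ _)) (≡.trans (≡.cong τ eq) (τσ i′)))
      unpermute : ∀ w → Covers i′ (a w ∘ σ) (p ∘ σ) → Covers (σ i′) (a w) p
      unpermute w cov {j} j≢ = ≡.subst (λ l → a w l ≤ p l × p l ≤ a w l + 1#) (στ j)
        (cov λ eq → j≢ (≡.trans (≡.sym (στ j)) (≡.cong σ eq)))

    -- The line lies in none of the hyperplanes spanned by lateral faces, so closed and open
    -- covering agree on it.
    Generic : (Fin k → Point d) → Fin d → Point d → Set
    Generic a i p = ∀ {w j} → j ≢ i → ¬ (p j ≈ a w j) × ¬ (p j ≈ a w j + 1#)

    generic⇒openCovers : ∀ {a : Fin k → Point d} {i p w} → Generic a i p → Covers i (a w) p → OpenCovers i (a w) p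
    generic⇒openCovers gen cov j≢i =
      let l , r = cov j≢i ; ≉l , ≉r = gen j≢i in ≤∧≉⇒< l (≉l ∘ sym) , ≤∧≉⇒< r ≉r

    -- Moving the line by the same small amount in every direction breaks no strict inequality.
    SeesAt-generic : ∀ {a : Fin k → Point d} {i W u v} → Sees a i W u v →
                     ∃[ p ] Generic a i p × SeesAt a i W u v p
    SeesAt-generic {a} {i} {W} {u} {v} (p , s) = q , generic , record
      { coversˡ = perturb u coversˡ
      ; coversʳ = perturb v coversʳ
      ; apart   = apart
      ; clear   = λ {w} w∈W w≢u w≢v cov → clear w∈W w≢u w≢v (unperturb w cov)
      }
      where
      open SeesAt s
      small = eventually-∀ λ w → eventually-∀ λ j → eventually-×
        (eventually-→ {p j < a w j} eventually-<) (eventually-→ {p j < a w j + 1#} eventually-<)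
      δ = proj₁ small
      0<δ = proj₁ (proj₂ small)
      still-below = proj₂ (proj₂ small) 0<δ ≤-refl
      q : Point d
      q j = p j + δ
      p<q : ∀ j → p j < q j
      p<q j = x<x+y (p j) 0<δ
      ≉-above : ∀ {j} y → (p j < y → q j < y) → ¬ (q j ≈ y)
      ≉-above {j} y below q≈y = <-irrefl q≈y (below (<-respʳ-≈ q≈y (p<q j)))
      generic : Generic a i q
      generic {w} {j} _ = ≉-above (a w j) (proj₁ (still-below w j)) , ≉-above (a w j + 1#) (proj₂ (still-below w j))
      perturb : ∀ w → OpenCovers i (a w) p → OpenCovers i (a w) q
      perturb w cov {j} j≢i =
        <-trans (proj₁ (cov j≢i)) (p<q j) , proj₂ (still-below w j) (proj₂ (cov j≢i))
      unperturb : ∀ w → Covers i (a w) q → Covers i (a w) p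
      unperturb w cov {j} j≢i =
        ≮⇒≥ (λ p<a → <⇒≱ (proj₁ (still-below w j) p<a) (proj₁ (cov j≢i)))
        , <⇒≤ (<-≤-trans (p<q j) (proj₂ (cov j≢i)))

    module _ (a : Fin k → Point d) (i : Fin d) where

      Below : Fin k → Fin k → Set
      Below u v = a u i < a v i

      private
        Below-isStrictPartialOrder = On.isStrictPartialOrder (λ u → a u i)
          (StrictTotalOrder.isStrictPartialOrder strictTotalOrder)

      Below-wellFounded : WellFounded Below
      Below-wellFounded = spo-wellFounded Below-isStrictPartialOrder

      Above-wellFounded : WellFounded (flip Below)
      Above-wellFounded = spo-noetherian Below-isStrictPartialOrder

      -- What pairwise disjointness amounts to on one line; disjoint panels and disjoint cubes both
      -- provide it.
      DistinctHeights : Pred (Fin k) 0ℓ → Point d → Set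
      DistinctHeights W p = ∀ {x y} → x ∈ W → y ∈ W → x ≢ y →
        Covers i (a x) p → Covers i (a y) p → ¬ (a x i ≈ a y i)

      -- Take `z` lowest among the objects on the line above `u`. Genericity lets the line run
      -- through the interiors of both, and distinct heights exclude a blocker level with `u` or
      -- `z`.
      next : ∀ {W p} → Generic a i p → DistinctHeights W p → ∀ {u v} →
             u ∈ W → Covers i (a u) p → v ∈ W → Covers i (a v) p → Below u v →
             ∃[ z ] z ∈ W × Covers i (a z) p × Below u z × a z i ≤ a v i × SeesAt a i W u z p
      next {W} {p} generic distinct {u} {v} u∈W covᵘ v∈W covᵛ u<v
        with minimal Below-wellFounded {P = λ z → z ∈ W × Covers i (a z) p × Below u z} (v∈W , covᵛ , u<v)
      ... | z , (z∈W , covᶻ , u<z) , lowest =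
        z , z∈W , covᶻ , u<z , ≮⇒≥ (lowest (v∈W , covᵛ , u<v)) , record
        { coversˡ = generic⇒openCovers {a} {w = u} generic covᵘ
        ; coversʳ = generic⇒openCovers {a} {w = z} generic covᶻ
        ; apart   = λ u≈z → <-irrefl u≈z u<z
        ; clear   = clear
        }
        where
        clear : ∀ {w} → w ∈ W → w ≢ u → w ≢ z → Covers i (a w) p → ¬ Between (a u i) (a w i) (a z i)
        clear w∈W w≢u w≢z covʷ (inj₁ (u≤w , w≤z)) =
          distinct w∈W z∈W w≢z covʷ covᶻ (≤-antisym w≤z (≮⇒≥ (lowest (w∈W , covʷ , u<w))))
          where u<w = ≤∧≉⇒< u≤w (distinct w∈W u∈W w≢u covʷ covᵘ ∘ sym)
        clear w∈W w≢u w≢z covʷ (inj₂ (z≤w , w≤u)) = <⇒≱ u<z (≤-trans z≤w w≤u)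

-- Channels of positive diameter versus single lines.

module Views (ℝ : CompleteOrderedField) where
  open OrderedField ℝ
  open Visibility ℝ
  open Geometry ℝ

  -- The radius is smaller than every positive gap between a coordinate of `p` and a face. Hence an
  -- object whose interior the line traverses contains the whole cross-section of the tube, and an
  -- object missed by the line is missed by the tube.
  tube : ∀ {k d} (a : Fin k → Point d) (i : Fin d) (p : Point d) → ∃[ r ] 0# < r ×
         (∀ w {x} → distToAxis² i p x ≤ r * r →
            (OpenCovers i (a w) p → Covers i (a w) x) × (Covers i (a w) x → Covers i (a w) p))
  tube a i p = r , 0<r , λ w {x} near → let
      x≤p+r = λ {j} j≢i → x≤y+r 0<r (≤-trans (square≤dist i p x {j} j≢i) near)
      p≤x+r = λ {j} j≢i → y≤x+r 0<r (≤-trans (square≤dist i p x {j} j≢i) near)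
    in
      (λ cov {j} j≢i → let m₁ , m₂ , m₃ , m₄ = margin w j ; l , u = cov j≢i in
         <⇒≤ (+-cancelʳ-< r (<-≤-trans (m₂ l) (p≤x+r j≢i)))
         , <⇒≤ (≤-<-trans (x≤p+r j≢i) (m₃ u)))
    , (λ cov {j} j≢i → let m₁ , m₂ , m₃ , m₄ = margin w j ; l , u = cov j≢i in
         ≮⇒≥ (λ p<a → <⇒≱ (m₁ p<a) (≤-trans l (x≤p+r j≢i)))
         , ≮⇒≥ (λ a+1<p → <⇒≱ (+-cancelʳ-< r (<-≤-trans (m₄ a+1<p) (p≤x+r j≢i))) u))
    where
    gap : ∀ x y → Eventually (λ s → x < y → x + s < y)
    gap x y = eventually-→ eventually-<
    small = eventually-∀ λ w → eventually-∀ λ j →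
      eventually-× (gap (p j) (a w j)) (eventually-× (gap (a w j) (p j))
        (eventually-× (gap (p j) (a w j + 1#)) (gap (a w j + 1#) (p j))))
    r = proj₁ small
    0<r = proj₁ (proj₂ small)
    margin = proj₂ (proj₂ small) 0<r ≤-refl

  module _ {m : ℕ} where

    top : Fin (ℕ.suc m)
    top = fromℕ m

    panel⇒covers : ∀ {a x : Point (ℕ.suc m)} → x ∈ Panel a → Covers top a x
    panel⇒covers (x∈ , _) {j} j≢top with view j
    ... | ‵fromℕ      = contradiction ≡.refl j≢top
    ... | ‵inject₁ j′ = x∈ j′

    covers⇒panel : ∀ {a x : Point (ℕ.suc m)} → Covers top a x → x top ≈ a top → x ∈ Panel a
    covers⇒panel cov x≈a = (λ j → cov (fromℕ≢inject₁ ∘ ≡.sym)) , x≈a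

  covers-axis : ∀ {d} {i : Fin d} {a p} t → Covers i a p → Covers i a (p [ i ≔ t ])
  covers-axis {p = p} t cov j≢i =
    ≤-trans (proj₁ (cov j≢i)) (≈⇒≤ (sym (≔-minimal p j≢i)))
    , ≤-trans (≈⇒≤ (≔-minimal p j≢i)) (proj₂ (cov j≢i))

  module Channels {k d : ℕ} (G : Graph k) (O : Fin k → Region d) (a : Fin k → Point d) (i : Fin d) where

    Clear : Cylinder i → Fin k → Fin k → Set
    Clear C u v = ∀ {w} → w ∈ V G → w ≢ u → w ≢ v → Cylinder.Solid C ⊥ O w

    Upward : Cylinder i → Fin k → Fin k → Set
    Upward C u v = Base start ⊆ O u × Base end ⊆ O v × Clear C u v
      where open Cylinder C

    -- Cylinders run from `start` up to `end`, so the two alternatives of `Joins` are upward views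
    -- from `u` to `v` and from `v` to `u`; symmetry reduces to the first.
    seesAlong⇒sees : (∀ {u v} → u ∈ V G → v ∈ V G → u ≢ v → ∀ C → Upward C u v → Sees a i (V G) u v) →
                     ∀ {u v} → u ∈ V G → v ∈ V G → u ≢ v → SeesAlong G O i u v → Sees a i (V G) u v
    seesAlong⇒sees upward u∈V v∈V u≢v (C , inj₁ (start⊆ , end⊆) , clear) =
      upward u∈V v∈V u≢v C ((λ {x} → start⊆ {x}) , (λ {x} → end⊆ {x}) , clear)
    seesAlong⇒sees upward u∈V v∈V u≢v (C , inj₂ (start⊆ , end⊆) , clear) =
      Sees-sym (upward v∈V u∈V (u≢v ∘ ≡.sym) C
        ((λ {x} → start⊆ {x}) , (λ {x} → end⊆ {x}) , λ w∈V w≢v w≢u → clear w∈V w≢u w≢v))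

    sees⇒seesAlong : (∀ {u v} → u ∈ V G → v ∈ V G → u ≢ v → a u i < a v i → Sees a i (V G) u v →
                        ∃[ C ] Upward C u v) →
                     ∀ {u v} → u ∈ V G → v ∈ V G → u ≢ v → Sees a i (V G) u v → SeesAlong G O i u v
    sees⇒seesAlong upward {u} {v} u∈V v∈V u≢v s with compare (a u i) (a v i)
    ... | tri≈ _ u≈v _ = contradiction u≈v (SeesAt.apart (proj₂ s))
    ... | tri< u<v _ _ with upward u∈V v∈V u≢v u<v s
    ...   | C , start⊆ , end⊆ , clear = C , inj₁ ((λ {x} → start⊆ {x}) , λ {x} → end⊆ {x}) , clear
    sees⇒seesAlong upward {u} {v} u∈V v∈V u≢v s | tri> _ _ v<u
      with upward v∈V u∈V (u≢v ∘ ≡.sym) v<u (Sees-sym s)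
    ... | C , start⊆ , end⊆ , clear =
      C , inj₂ ((λ {x} → start⊆ {x}) , λ {x} → end⊆ {x}) , λ w∈V w≢u w≢v → clear w∈V w≢v w≢u

  module Panels {k m : ℕ} (G : Graph k) (a : Fin k → Point (ℕ.suc m)) where

    private
      O : Fin k → Region (ℕ.suc m)
      O v = Panel (a v)

      module C = Channels G O a top

    panel-axis : ∀ {b : Point (ℕ.suc m)} {p t} → Covers top b p → t ≈ b top → p [ top ≔ t ] ∈ Panel b
    panel-axis {b} {p} {t} cov t≈b =
      covers⇒panel {a = b} {p [ top ≔ t ]} (covers-axis {a = b} {p} t cov) (trans (≔-updates p top) t≈b)

    -- The line is the axis of the channel; a blocking panel would contain the point of the axis at
    -- its own height.
    panel-seesAlong⇒sees : ∀ {u v} → u ∈ V G → v ∈ V G → u ≢ v → SeesAlong G O top u v → Sees a top (V G) u v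
    panel-seesAlong⇒sees = C.seesAlong⇒sees λ {u} {v} u∈V v∈V u≢v C (start⊆ , end⊆ , clear) → let
        open Cylinder C
        start≈ : start ≈ a u top
        start≈ = trans (sym (≔-updates centre top)) (proj₂ (start⊆ {axis C start} (axis∈Base C start)))
        end≈ : end ≈ a v top
        end≈ = trans (sym (≔-updates centre top)) (proj₂ (end⊆ {axis C end} (axis∈Base C end)))
      in centre , record
        { coversˡ = base⇒openCovers C {a u} (λ {x} x∈ → panel⇒covers {a = a u} {x} (start⊆ {x} x∈))
        ; coversʳ = base⇒openCovers C {a v} (λ {x} x∈ → panel⇒covers {a = a v} {x} (end⊆ {x} x∈))
        ; apart   = λ u≈v → <-irrefl (trans start≈ (trans u≈v (sym end≈))) start<end
        ; clear   = λ {w} w∈V w≢u w≢v cov → λ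
            { (inj₁ (u≤w , w≤v)) → clear w∈V w≢u w≢v {axis C (a w top)}
                ( axis∈Solid C (≤-trans (≈⇒≤ start≈) u≤w) (≤-trans w≤v (≈⇒≤ (sym end≈)))
                , panel-axis {a w} {centre} cov refl)
            ; (inj₂ (v≤w , w≤u)) → <⇒≱ start<end
                (≤-trans (≈⇒≤ end≈) (≤-trans v≤w (≤-trans w≤u (≈⇒≤ (sym start≈)))))
            }
        }

    panel-sees⇒seesAlong : ∀ {u v} → u ∈ V G → v ∈ V G → u ≢ v → Sees a top (V G) u v → SeesAlong G O top u v
    panel-sees⇒seesAlong = C.sees⇒seesAlong λ {u} {v} u∈V v∈V u≢v u<v (p , s) → let
        open SeesAt s
        r , 0<r , near = tube a top p
      in record { centre = p ; radius = r ; radius>0 = 0<r ; start = a u top ; end = a v top ; start<end = u<v }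
       , (λ {x} (x≈ , x-near) → covers⇒panel {a = a u} {x} (proj₁ (near u {x} x-near) coversˡ) x≈)
       , (λ {x} (x≈ , x-near) → covers⇒panel {a = a v} {x} (proj₁ (near v {x} x-near) coversʳ) x≈)
       , λ {w} w∈V w≢u w≢v {x} (((u≤x , x≤v) , x-near) , x∈) →
           clear w∈V w≢u w≢v (proj₂ (near w {x} x-near) (panel⇒covers {a = a w} {x} x∈))
             (inj₁ (≤-trans u≤x (≈⇒≤ (proj₂ x∈)) , ≤-trans (≈⇒≤ (sym (proj₂ x∈))) x≤v))

    panel-distinctHeights : PairwiseDisjoint G O → ∀ p → DistinctHeights a top (V G) p
    panel-distinctHeights disjoint p {x} {y} x∈V y∈V x≢y covˣ covʸ x≈y =
      disjoint x∈V y∈V x≢y {p [ top ≔ a x top ]} (panel-axis {a x} {p} covˣ refl , panel-axis {a y} {p} covʸ x≈y)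

  module Cubes {k d : ℕ} (G : Graph k) (a : Fin k → Point d) (i : Fin d)
               (disjoint : PairwiseDisjoint G (λ v → Cube (a v))) where

    private
      O : Fin k → Region d
      O v = Cube (a v)

      module C = Channels G O a i

    covers⇒cube : ∀ {b x : Point d} → Covers i b x → b i ≤ x i → x i ≤ b i + 1# → x ∈ Cube b
    covers⇒cube cov b≤x x≤b+1 j with j ≟ i
    ... | yes ≡.refl = b≤x , x≤b+1
    ... | no j≢i     = cov j≢i

    cube-axis : ∀ {b p : Point d} {t} → Covers i b p → b i ≤ t → t ≤ b i + 1# → p [ i ≔ t ] ∈ Cube b
    cube-axis {b} {p} {t} cov b≤t t≤b+1 = covers⇒cube {b} {p [ i ≔ t ]} (covers-axis {a = b} {p} t cov)
      (≤-trans b≤t (≈⇒≤ (sym (≔-updates p i)))) (≤-trans (≈⇒≤ (≔-updates p i)) t≤b+1)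

    x≤x+1 : ∀ x → x ≤ x + 1#
    x≤x+1 x = <⇒≤ (x<x+y x 0<1)

    -- Otherwise the point over `p` at the height of the bottom of `y` lies in both cubes. Along a
    -- line the cubes are therefore ordered as their bottoms are.
    stacked : ∀ {x y p} → x ∈ V G → y ∈ V G → x ≢ y → Covers i (a x) p → Covers i (a y) p →
              a x i ≤ a y i → a x i + 1# < a y i
    stacked {x} {y} {p} x∈V y∈V x≢y covˣ covʸ x≤y = ≰⇒> λ y≤x+1 →
      disjoint x∈V y∈V x≢y {p [ i ≔ a y i ]}
        (cube-axis {a x} {p} covˣ x≤y y≤x+1 , cube-axis {a y} {p} covʸ ≤-refl (x≤x+1 _))

    cube-distinctHeights : ∀ p → DistinctHeights a i (V G) p
    cube-distinctHeights p x∈V y∈V x≢y covˣ covʸ x≈y =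
      <-irrefl x≈y (<-trans (x<x+y _ 0<1) (stacked {p = p} x∈V y∈V x≢y covˣ covʸ (≈⇒≤ x≈y)))

    -- A channel may start and end anywhere in the two cubes, so their order is recovered first: if
    -- `v` were not above `u`, `stacked` would put `end` below `start`. The bottom of a blocker is
    -- above the top of `u`, again by `stacked`, so the axis of the channel meets it.
    cube-seesAlong⇒sees : ∀ {u v} → u ∈ V G → v ∈ V G → u ≢ v → SeesAlong G O i u v → Sees a i (V G) u v
    cube-seesAlong⇒sees = C.seesAlong⇒sees λ {u} {v} u∈V v∈V u≢v C (start⊆ , end⊆ , clear) → let
        open Cylinder C
        coversᵘ = base⇒openCovers C {a u} (λ {x} x∈ {j} _ → start⊆ {x} x∈ j)
        coversᵛ = base⇒openCovers C {a v} (λ {x} x∈ {j} _ → end⊆ {x} x∈ j)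
        covᵘ = λ {j} → open⇒covers {a = a u} {centre} coversᵘ {j}
        covᵛ = λ {j} → open⇒covers {a = a v} {centre} coversᵛ {j}
        u≤start = ≤-trans (proj₁ (start⊆ (axis∈Base C start) i)) (≈⇒≤ (≔-updates centre i))
        start≤u+1 = ≤-trans (≈⇒≤ (sym (≔-updates centre i))) (proj₂ (start⊆ (axis∈Base C start) i))
        v≤end = ≤-trans (proj₁ (end⊆ (axis∈Base C end) i)) (≈⇒≤ (≔-updates centre i))
        end≤v+1 = ≤-trans (≈⇒≤ (sym (≔-updates centre i))) (proj₂ (end⊆ (axis∈Base C end) i))
        v≰u : ¬ (a v i ≤ a u i)
        v≰u v≤u = <⇒≱ start<end (≤-trans end≤v+1 (≤-trans
          (<⇒≤ (stacked {p = centre} v∈V u∈V (u≢v ∘ ≡.sym) covᵛ covᵘ v≤u)) u≤start))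
      in centre , record
        { coversˡ = coversᵘ
        ; coversʳ = coversᵛ
        ; apart   = λ u≈v → v≰u (≈⇒≤ (sym u≈v))
        ; clear   = λ {w} w∈V w≢u w≢v cov → λ
            { (inj₁ (u≤w , w≤v)) → clear w∈V w≢u w≢v {axis C (a w i)}
                ( axis∈Solid C
                    (≤-trans start≤u+1 (<⇒≤ (stacked {p = centre} u∈V w∈V (w≢u ∘ ≡.sym) covᵘ cov u≤w)))
                    (≤-trans w≤v v≤end)
                , cube-axis {a w} {centre} cov ≤-refl (x≤x+1 _))
            ; (inj₂ (v≤w , w≤u)) → v≰u (≤-trans v≤w w≤u)
            }
        }

    -- The channel goes from bottom to bottom, through the cube of `u` itself, which is harmless
    -- since only other cubes must be avoided. A cube met by the channel cannot have its bottom
    -- below that of `u`: by `stacked` it would end before the channel starts.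
    cube-sees⇒seesAlong : ∀ {u v} → u ∈ V G → v ∈ V G → u ≢ v → Sees a i (V G) u v → SeesAlong G O i u v
    cube-sees⇒seesAlong = C.sees⇒seesAlong λ {u} {v} u∈V v∈V u≢v u<v (p , s) → let
        open SeesAt s
        r , 0<r , near = tube a i p
        bottom : ∀ w → OpenCovers i (a w) p → ∀ {x} → x i ≈ a w i → distToAxis² i p x ≤ r * r → x ∈ Cube (a w)
        bottom w cov {x} x≈ x-near = covers⇒cube {a w} {x} (proj₁ (near w {x} x-near) cov)
          (≈⇒≤ (sym x≈)) (≤-trans (≈⇒≤ x≈) (x≤x+1 _))
      in record { centre = p ; radius = r ; radius>0 = 0<r ; start = a u i ; end = a v i ; start<end = u<v }
       , (λ {x} (x≈ , x-near) → bottom u coversˡ {x} x≈ x-near)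
       , (λ {x} (x≈ , x-near) → bottom v coversʳ {x} x≈ x-near)
       , λ {w} w∈V w≢u w≢v {x} (((u≤x , x≤v) , x-near) , x∈) → let
             cov = λ {j} → proj₂ (near w {x} x-near) (λ {j} _ → x∈ j) {j}
             covᵘ = λ {j} → open⇒covers {a = a u} {p} coversˡ {j}
             u≤w = ≮⇒≥ λ w<u → <⇒≱
               (stacked {p = p} w∈V u∈V w≢u cov covᵘ (<⇒≤ w<u)) (≤-trans u≤x (proj₂ (x∈ i)))
           in clear w∈V w≢u w≢v cov (inj₁ (u≤w , ≤-trans (proj₁ (x∈ i)) x≤v))

-- From cubes to forests of panels.

transpose-matchˡ : ∀ {n} (i j : Fin n) → transpose i j i ≡ j
transpose-matchˡ i j rewrite dec-true (i ≟ i) ≡.refl = ≡.refl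

acyclic-⊆ : ∀ {k} {H G : Graph k} → H IsSubgraphOf G → IsAcyclic G → IsAcyclic H
acyclic-⊆ H⊆G acyclic v vs c = acyclic v vs
  (record { length≥3 = length≥3 ; distinct = distinct ; closed = Linked.map (_IsSubgraphOf_.Adj-⊆ H⊆G) closed })
  where open IsCycle c

module Forward (ℝ : CompleteOrderedField) where
  open OrderedField ℝ
  open Visibility ℝ
  open Classical excludedMiddle
  open Geometry ℝ
  open Views ℝ

  Decomposes : ∀ m {k} → Graph k → Set₁
  Decomposes m {k} T = Σ[ H ∈ (Fin (ℕ.suc m) → Graph k) ]
    T IsUnionOf H × (∀ i → IsOrthogonalVisibilityForest m (H i))

  SeesAlong-sym : ∀ {k d} {G : Graph k} {O : Fin k → Region d} {i u v} →
                  SeesAlong G O i u v → SeesAlong G O i v u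
  SeesAlong-sym (C , joins , clear) = C , swap joins , λ w∈V w≢v w≢u → clear w∈V w≢u w≢v

  panel⇒cube : ∀ {m} {b x : Point (ℕ.suc m)} → x ∈ Panel b → x ∈ Cube b
  panel⇒cube {b = b} {x} x∈ j with view j
  ... | ‵fromℕ      = ≈⇒≤ (sym (proj₂ x∈)) , ≤-trans (≈⇒≤ (proj₂ x∈)) (<⇒≤ (x<x+y _ 0<1))
  ... | ‵inject₁ j′ = proj₁ x∈ j′

  module _ {m k : ℕ} (T : Graph k) (acyclic : IsAcyclic T) (a : Fin k → Point (ℕ.suc m)) where

    O : Fin k → Region (ℕ.suc m)
    O v = Cube (a v)

    module _ (disjoint : PairwiseDisjoint T O)
             (adj⇔ : ∀ {u v} → u ∈ V T → v ∈ V T → u ≢ v → Adj T u v ⇔ (∃[ i ] SeesAlong T O i u v)) where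

      Along : Fin (ℕ.suc m) → Graph k
      Along i = record
        { V          = V T
        -- Distinctness is imposed because a channel within one cube lets that cube see itself.
        ; Adj        = λ u v → u ∈ V T × v ∈ V T × u ≢ v × SeesAlong T O i u v
        ; Adj⇒V      = proj₁
        ; Adj-sym    = λ (u∈V , v∈V , u≢v , s) → v∈V , u∈V , u≢v ∘ ≡.sym , SeesAlong-sym {G = T} {O} s
        ; Adj-irrefl = λ (_ , _ , v≢v , _) → v≢v ≡.refl
        }

      Along-⊆ : ∀ i → Along i IsSubgraphOf T
      Along-⊆ i = record
        { V-⊆   = id
        ; Adj-⊆ = λ (u∈V , v∈V , u≢v , s) → Equivalence.from (adj⇔ u∈V v∈V u≢v) (i , s)
        }

      union : T IsUnionOf Along
      union = record
        { subgraph  = Along-⊆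
        ; V-cover   = λ v∈V → zero , v∈V
        ; Adj-cover = λ {u} {v} u~v → let
              u∈V = Adj⇒V T u~v
              v∈V = Adj⇒V T (Adj-sym T u~v)
              u≢v = λ u≡v → Adj-irrefl T {u} (≡.subst (Adj T u) (≡.sym u≡v) u~v)
              i , s = Equivalence.to (adj⇔ u∈V v∈V u≢v) u~v
            in i , u∈V , v∈V , u≢v , s
        }

      module _ (i : Fin (ℕ.suc m)) (x : Fin k) where

        open Cubes T a i disjoint

        K : Graph k
        K = Component (Along i) x

        -- The transposition makes the `i`-th axis the last one, along which panels see each other.
        σ τ : Fin (ℕ.suc m) → Fin (ℕ.suc m)
        σ = transpose top i
        τ = transpose i top

        panels : Fin k → Point (ℕ.suc m)
        panels v = a v ∘ σ

        -- After undoing the transposition, each panel is the bottom face of its cube.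
        panels-disjoint : PairwiseDisjoint K (λ v → Panel (panels v))
        panels-disjoint {u} {v} (u∈V , _) (v∈V , _) u≢v {y} (y∈u , y∈v) =
          disjoint u∈V v∈V u≢v {y ∘ τ} (unpermute u y∈u , unpermute v y∈v)
          where
          unpermute : ∀ w → y ∈ Panel (panels w) → y ∘ τ ∈ Cube (a w)
          unpermute w y∈ j = ≡.subst (λ l → a w l ≤ y (τ j) × y (τ j) ≤ a w l + 1#) (transpose-inverse top i)
            (panel⇒cube {b = panels w} {y} y∈ (τ j))

        -- The next object `z` is sought among all vertices of `T`. Being seen by `u` along the
        -- axis, it belongs to the component; as the view from `u` to `v` is clear within the
        -- component, `z` must be `v`.
        upward : ∀ {u v p} → u ∈ V K → v ∈ V K → Generic a i p → SeesAt a i (V K) u v p →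
                 a u i < a v i → Adj K u v
        upward {u} {v} {p} (u∈V , x⇝u) v∈K@(v∈V , _) generic s u<v
          with next a i {V T} generic (cube-distinctHeights p) u∈V (open⇒covers {a = a u} {p} coversˡ)
                 v∈V (open⇒covers {a = a v} {p} coversʳ) u<v
          where open SeesAt s
        ... | z , z∈V , covᶻ , u<z , z≤v , sᶻ = adj
          where
          u≢z : u ≢ z
          u≢z u≡z = <-irrefl (≡⇒≈ (≡.cong (λ w → a w i) u≡z)) u<z
          u~z : Adj (Along i) u z
          u~z = u∈V , z∈V , u≢z , cube-sees⇒seesAlong u∈V z∈V u≢z (p , sᶻ)
          adj : Adj K u v
          adj with z ≟ v
          ... | yes ≡.refl = u~z , x⇝u
          ... | no z≢v = contradiction (inj₁ (<⇒≤ u<z , z≤v))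
            (SeesAt.clear s (z∈V , x⇝u ◅◅ u~z ◅ ε) (u≢z ∘ ≡.sym) z≢v covᶻ)

        sees⇒adj : ∀ {u v} → u ∈ V K → v ∈ V K → Sees a i (V K) u v → Adj K u v
        sees⇒adj {u} {v} u∈K v∈K sees = ordered (SeesAt-generic sees)
          where
          ordered : ∃[ p ] Generic a i p × SeesAt a i (V K) u v p → Adj K u v
          ordered (p , generic , s) = [ upward {u} {v} {p} u∈K v∈K generic s
            , Adj-sym K {v} {u} ∘ upward {v} {u} {p} v∈K u∈K generic (SeesAt-sym s) ]′
            (≉⇒<⊎> (SeesAt.apart s))

        component-orthogonal : IsOrthogonalVisibilityGraph m K
        component-orthogonal = panels , panels-disjoint , λ {u} {v} u∈K v∈K u≢v → mk⇔
          (λ ((u∈V , v∈V , _ , s) , _) → panel-sees⇒seesAlong u∈K v∈K u≢v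
            (Sees-⊆ proj₁ (Sees-permute σ τ (λ j → transpose-inverse top i) (λ j → transpose-inverse i top)
              (transpose-matchˡ top i) (cube-seesAlong⇒sees u∈V v∈V u≢v s))))
          (λ s → sees⇒adj u∈K v∈K
            (Sees-cong {a = λ w → panels w ∘ τ} (λ {w} _ j → ≡.cong (a w) (≡.sym (transpose-inverse top i))) u∈K v∈K
              (Sees-permute τ σ (λ j → transpose-inverse i top) (λ j → transpose-inverse top i)
                (transpose-matchˡ i top) (panel-seesAlong⇒sees u∈K v∈K u≢v s))))
          where open Panels K panels

      forest : ∀ i → IsOrthogonalVisibilityForest m (Along i)
      forest i with components (Along i)
      ... | l , x , x∈V , along-union , separate = l , (λ c → Component (Along i) (x c)) , along-union , separate ,
        λ c → Component-isTree (Along i) (acyclic-⊆ (Along-⊆ i) acyclic) (x∈V c) , component-orthogonal i (x c)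

  decompose : ∀ {m k} (T : Graph k) → IsAcyclic T → IsCubeVisibilityGraph (ℕ.suc m) T → Decomposes m T
  decompose T acyclic (a , disjoint , adj⇔) =
    Along T acyclic a (λ {u} {v} → disjoint {u} {v}) adj⇔ ,
    union T acyclic a (λ {u} {v} → disjoint {u} {v}) adj⇔ ,
    forest T acyclic a (λ {u} {v} → disjoint {u} {v}) adj⇔

-- Rank functions, and integration of prescribed increments over an acyclic graph.

module Potentials (ℝ : CompleteOrderedField) where
  open OrderedField ℝ
  open Classical excludedMiddle
  open Sum +-commutativeMonoid using (sum; sum-cong-≋)

  sum-differ : ∀ {n} {s t : Vector Carrier n} e → (∀ {l} → l ≢ e → s l ≈ t l) →
               sum s + t e ≈ sum t + s e
  sum-differ {s = s} {t} zero s≈t = begin-equality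
    (s₀ + sum (s ∘ suc)) + t₀  ≈⟨ +-comm _ _ ⟩
    t₀ + (s₀ + sum (s ∘ suc))  ≈⟨ +-congˡ (+-comm _ _) ⟩
    t₀ + (sum (s ∘ suc) + s₀)  ≈⟨ +-congˡ (+-congʳ (sum-cong-≋ {x = s ∘ suc} {y = t ∘ suc} λ l → s≈t λ ())) ⟩
    t₀ + (sum (t ∘ suc) + s₀)  ≈⟨ +-assoc _ _ _ ⟨
    (t₀ + sum (t ∘ suc)) + s₀  ∎
    where
    open ≤-Reasoning
    s₀ = s zero
    t₀ = t zero
  sum-differ {s = s} {t} (suc e) s≈t = trans (+-assoc _ _ _)
    (trans (+-cong (s≈t λ ()) (sum-differ e λ l≢e → s≈t λ { ≡.refl → l≢e ≡.refl })) (sym (+-assoc _ _ _)))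

  sum-mono : ∀ {n} {s t : Vector Carrier n} → (∀ l → s l ≤ t l) → sum s ≤ sum t
  sum-mono {ℕ.zero}  _   = ≤-refl
  sum-mono {ℕ.suc n} s≤t = +-mono-≤ (s≤t zero) (sum-mono (s≤t ∘ suc))

  sum-gap : ∀ {n M} {s t : Vector Carrier n} → (∀ l → s l ≤ t l) → ∀ e → s e + M ≤ t e → sum s + M ≤ sum t
  sum-gap {M = M} {s} s≤t zero gap = ≤-trans
    (≈⇒≤ (trans (+-assoc _ _ _) (trans (+-congˡ (+-comm _ _)) (sym (+-assoc _ _ _)))))
    (+-mono-≤ gap (sum-mono (s≤t ∘ suc)))
  sum-gap s≤t (suc e) gap = ≤-trans (≈⇒≤ (+-assoc _ _ _)) (+-mono-≤ (s≤t zero) (sum-gap (s≤t ∘ suc) e gap))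

  select : ∀ {P : Set} → Dec P → Carrier → Carrier → Carrier
  select (yes _) x y = x
  select (no _)  x y = y

  select-yes : ∀ {P : Set} (P? : Dec P) {x y} → P → select P? x y ≈ x
  select-yes (yes _) p = refl
  select-yes (no ¬p) p = contradiction p ¬p

  select-no : ∀ {P : Set} (P? : Dec P) {x y} → ¬ P → select P? x y ≈ y
  select-no (yes p) ¬p = contradiction p ¬p
  select-no (no _)  ¬p = refl

  select-mono : ∀ {P Q : Set} (P? : Dec P) (Q? : Dec Q) {x y} → y ≤ x → (P → Q) →
                select P? x y ≤ select Q? x y
  select-mono (yes p) (yes q) y≤x P→Q = ≤-refl
  select-mono (yes p) (no ¬q) y≤x P→Q = contradiction (P→Q p) ¬q
  select-mono (no ¬p) (yes q) y≤x P→Q = y≤x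
  select-mono (no ¬p) (no ¬q) y≤x P→Q = ≤-refl

  module Spread {k : ℕ} {_~_ : Rel (Fin k) 0ℓ} (~-isEquivalence : IsEquivalence _~_)
                (φ : Fin k → Carrier) (φ-cong : ∀ {u v} → u ~ v → φ u ≈ φ v)
                {M : Carrier} (0<M : 0# < M) where

    private
      module ~ = IsEquivalence ~-isEquivalence

      least~ : ∀ v → ∃[ y ] v ~ y × (∀ {z} → v ~ z → ¬ z <ᶠ y)
      least~ v = least {P = v ~_} ~.refl

      rep : Fin k → Fin k
      rep v = proj₁ (least~ v)

      v~rep : ∀ v → v ~ rep v
      v~rep v = proj₁ (proj₂ (least~ v))

      rep-cong : ∀ {u v} → u ~ v → rep u ≡ rep v
      rep-cong {u} {v} u~v with <ᶠ-cmp (rep u) (rep v)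
      ... | tri< lt _ _ = contradiction lt (proj₂ (proj₂ (least~ v)) (~.trans (~.sym u~v) (v~rep u)))
      ... | tri≈ _ eq _ = eq
      ... | tri> _ _ gt = contradiction gt (proj₂ (proj₂ (least~ u)) (~.trans u~v (v~rep v)))

      -- Lexicographic: first by `φ`, then by the least vertex of the class. The incomparable pairs
      -- are exactly those related by `~`.
      _≺_ : Rel (Fin k) 0ℓ
      u ≺ v = φ u < φ v ⊎ (φ u ≈ φ v × rep u <ᶠ rep v)

      ≺-trans : ∀ {u v w} → u ≺ v → v ≺ w → u ≺ w
      ≺-trans (inj₁ u<v)       (inj₁ v<w)       = inj₁ (<-trans u<v v<w)
      ≺-trans (inj₁ u<v)       (inj₂ (v≈w , _)) = inj₁ (<-respʳ-≈ v≈w u<v)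
      ≺-trans (inj₂ (u≈v , _)) (inj₁ v<w)       = inj₁ (<-respˡ-≈ (sym u≈v) v<w)
      ≺-trans (inj₂ (u≈v , p)) (inj₂ (v≈w , q)) = inj₂ (trans u≈v v≈w , <ᶠ-trans p q)

      ≺-irrefl : ∀ {u} → ¬ u ≺ u
      ≺-irrefl (inj₁ u<u)       = <-irrefl refl u<u
      ≺-irrefl (inj₂ (_ , u<u)) = <ᶠ-irrefl ≡.refl u<u

      ≺-respʳ : ∀ {u v w} → u ~ v → w ≺ u → w ≺ v
      ≺-respʳ u~v (inj₁ w<u)       = inj₁ (<-respʳ-≈ (φ-cong u~v) w<u)
      ≺-respʳ {w = w} u~v (inj₂ (w≈u , p)) =
        inj₂ (trans w≈u (φ-cong u~v) , ≡.subst (rep w <ᶠ_) (rep-cong u~v) p)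

      ≺-connex : ∀ {u v} → ¬ u ~ v → u ≺ v ⊎ v ≺ u
      ≺-connex {u} {v} u≁v with compare (φ u) (φ v) | <ᶠ-cmp (rep u) (rep v)
      ... | tri< u<v _ _ | _ = inj₁ (inj₁ u<v)
      ... | tri> _ _ v<u | _ = inj₂ (inj₁ v<u)
      ... | tri≈ _ u≈v _ | tri< p _ _ = inj₁ (inj₂ (u≈v , p))
      ... | tri≈ _ u≈v _ | tri> _ _ p = inj₂ (inj₂ (sym u≈v , p))
      ... | tri≈ _ u≈v _ | tri≈ _ p _ =
        contradiction (~.trans (v~rep u) (≡.subst (_~ v) (≡.sym p) (~.sym (v~rep v)))) u≁v

      steps : Fin k → Vector Carrier k
      steps v w = select (excludedMiddle (w ≺ v)) M 0#

      steps-mono : ∀ {u v} → (∀ {w} → w ≺ u → w ≺ v) → ∀ w → steps u w ≤ steps v w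
      steps-mono ≺-mono w = select-mono (excludedMiddle _) (excludedMiddle _) (<⇒≤ 0<M) ≺-mono

    abstract
      -- This is `M` times the number of vertices preceding `v`.
      ψ : Fin k → Carrier
      ψ v = sum (steps v)

      ψ-cong : ∀ {u v} → u ~ v → ψ u ≈ ψ v
      ψ-cong u~v = ≤-antisym (sum-mono (steps-mono (≺-respʳ u~v))) (sum-mono (steps-mono (≺-respʳ (~.sym u~v))))

      -- By transitivity all that is counted for `u` is counted for `v`, and `u` itself is counted
      -- for `v` only.
      ψ-gap : ∀ {u v} → u ≺ v → ψ u + M ≤ ψ v
      ψ-gap {u} {v} u≺v = sum-gap (steps-mono λ w≺u → ≺-trans w≺u u≺v) u (≈⇒≤
        (trans (+-congʳ (select-no (excludedMiddle _) ≺-irrefl))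
          (trans (+-identityˡ M) (sym (select-yes (excludedMiddle _) u≺v)))))

      ψ-increasing : ∀ {u v} → φ u < φ v → ψ u + M ≤ ψ v
      ψ-increasing φu<φv = ψ-gap (inj₁ φu<φv)

      ψ-separated : ∀ {u v} → ¬ u ~ v → ψ u + M ≤ ψ v ⊎ ψ v + M ≤ ψ u
      ψ-separated u≁v = [ inj₁ ∘ ψ-gap , inj₂ ∘ ψ-gap ]′ (≺-connex u≁v)

  module Potential {k : ℕ} {G : Graph k} (acyclic : IsAcyclic G) {n : ℕ} {E : Fin n → Rel (Fin k) 0ℓ}
    (E⇒Adj : ∀ {i u v} → E i u v → Adj G u v)
    (E-sym : ∀ {i u v} → E i u v → E i v u)
    (E-unique : ∀ {i j u v} → E i u v → E j u v → i ≡ j)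
    (f : Fin n → Fin k → Carrier)
    where

    private
      -- The vertex `z` is on the side of `y` once the edge `xy` is deleted. The condition `x <ᶠ y`
      -- fixes one orientation, so that each edge counts once.
      Crossed : Fin k → Fin k → Fin k → Set
      Crossed z x y = (∃[ i ] E i x y) × x <ᶠ y × Star (Without acyclic x y) y z

      -- The colour is read off the proof of `Crossed`; uniqueness of colours makes the value
      -- independent of that proof.
      weight : ∀ {x y z} → Dec (Crossed z x y) → Carrier
      weight {x} {y} (yes ((i , _) , _)) = f i y - f i x
      weight         (no _)              = 0#

      weight-cong : ∀ {x y u v} (c : Dec (Crossed u x y)) (c′ : Dec (Crossed v x y)) →
                    (Crossed u x y → Crossed v x y) → (Crossed v x y → Crossed u x y) → weight c ≈ weight c′
      weight-cong (yes ((i , e) , _)) (yes ((i′ , e′) , _)) _ _ with E-unique e e′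
      ... | ≡.refl = refl
      weight-cong (yes c) (no ¬c) to from = contradiction (to c) ¬c
      weight-cong (no ¬c) (yes c) to from = contradiction (from c) ¬c
      weight-cong (no _)  (no _)  to from = refl

      weight-yes : ∀ {x y z i} (c : Dec (Crossed z x y)) → E i x y → Crossed z x y → weight c ≈ f i y - f i x
      weight-yes (yes ((i′ , e′) , _)) e _ with E-unique e′ e
      ... | ≡.refl = refl
      weight-yes (no ¬c) e c = contradiction c ¬c

      weight-no : ∀ {x y z} (c : Dec (Crossed z x y)) → ¬ Crossed z x y → weight c ≈ 0#
      weight-no (yes c) ¬c = contradiction c ¬c
      weight-no (no _)  ¬c = refl

      contribution : Fin k → Fin k × Fin k → Carrier
      contribution z (x , y) = weight (excludedMiddle (Crossed z x y))

      term : Fin k → Vector Carrier (k *ᴺ k)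
      term z e = contribution z (remQuot {k} k e)

    private
      -- The edge `uv` survives the deletion of a different edge `xy`, so its ends are on the same
      -- side. The orientations `u <ᶠ v` and `x <ᶠ y` exclude that `xy` is `uv` reversed.
      cross : ∀ {u v x y} → Adj G u v → u <ᶠ v → ¬ (x ≡ u × y ≡ v) → Crossed u x y → Crossed v x y
      cross u~v u<v xy≢uv (e , x<y , y⇝u) = e , x<y , y⇝u ◅◅ (u~v
        , (λ (u≡x , v≡y) → xy≢uv (≡.sym u≡x , ≡.sym v≡y))
        , (λ { (≡.refl , ≡.refl) → <ᶠ-irrefl ≡.refl (<ᶠ-trans u<v x<y) })) ◅ ε

      uncross : ∀ {u v x y} → Adj G u v → u <ᶠ v → ¬ (x ≡ u × y ≡ v) → Crossed v x y → Crossed u x y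
      uncross u~v u<v xy≢uv (e , x<y , y⇝v) = e , x<y , y⇝v ◅◅ Without-sym acyclic (u~v
        , (λ (u≡x , v≡y) → xy≢uv (≡.sym u≡x , ≡.sym v≡y))
        , (λ { (≡.refl , ≡.refl) → <ᶠ-irrefl ≡.refl (<ᶠ-trans u<v x<y) })) ◅ ε

    abstract
      -- The tree is cut at every edge xy; the increment of f along xy contributes
      -- to the vertices on the side of y.
      potential : Fin k → Carrier
      potential z = sum (term z)

      -- Only the summand of the edge `uv` changes. It is counted at `v`, and not at `u` because
      -- `uv` is a bridge.
      step : ∀ {i u v} → E i u v → u <ᶠ v → potential v - f i v ≈ potential u - f i u
      step {i} {u} {v} e u<v = begin-equality
        potential v - f i v                          ≈⟨ +-congʳ total ⟩
        (potential u + (f i v - f i u)) - f i v      ≈⟨ +-assoc _ _ _ ⟩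
        potential u + ((f i v - f i u) - f i v)      ≈⟨ +-congˡ (trans (+-congʳ (+-comm _ _)) (x+z-z≈x _ _)) ⟩
        potential u - f i u                          ∎
        where
        open ≤-Reasoning
        uv : Fin (k *ᴺ k)
        uv = combine u v
        remQuot-uv : remQuot {k} k uv ≡ (u , v)
        remQuot-uv = remQuot-combine u v
        elsewhere : ∀ {l} → l ≢ uv → term v l ≈ term u l
        elsewhere {l} l≢uv = weight-cong (excludedMiddle _) (excludedMiddle _)
          (uncross (E⇒Adj e) u<v ≢uv) (cross (E⇒Adj e) u<v ≢uv)
          where
          ≢uv : ¬ (proj₁ (remQuot {k} k l) ≡ u × proj₂ (remQuot {k} k l) ≡ v)
          ≢uv (p , q) = l≢uv (≡.trans (≡.sym (combine-remQuot {k} k l)) (≡.cong₂ combine p q))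
        at-v : term v uv ≈ f i v - f i u
        at-v = trans (≡⇒≈ (≡.cong (contribution v) remQuot-uv))
          (weight-yes (excludedMiddle _) e ((i , e) , u<v , ε))
        at-u : term u uv ≈ 0#
        at-u = trans (≡⇒≈ (≡.cong (contribution u) remQuot-uv))
          (weight-no (excludedMiddle _) λ (_ , _ , v⇝u) →
            bridge acyclic (E⇒Adj e) (Star.reverse (Without-sym acyclic) v⇝u))
        total : potential v ≈ potential u + (f i v - f i u)
        total = trans (sym (+-identityʳ _)) (trans (+-congˡ (sym at-u))
          (trans (sum-differ uv elsewhere) (+-congˡ at-v)))

      potential-step : ∀ {i u v} → E i u v → potential v - f i v ≈ potential u - f i u
      potential-step {u = u} {v} e with <ᶠ-cmp u v
      ... | tri< u<v _ _ = step e u<v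
      ... | tri≈ _ ≡.refl _ = refl
      ... | tri> _ _ v<u = sym (step (E-sym e) v<u)

    potential-monochromatic : ∀ {i u v} → Star (E i) u v → potential v - f i v ≈ potential u - f i u
    potential-monochromatic ε        = refl
    potential-monochromatic (e ◅ es) = trans (potential-monochromatic es) (potential-step e)

-- One family of panels for all trees of a forest.

module Backward (ℝ : CompleteOrderedField) where
  open OrderedField ℝ
  open Visibility ℝ
  open Geometry ℝ
  open Views ℝ

  -- Panel representations of the trees of the forest F, merged into one family b and
  -- rotated so that the panels see each other along the i-th axis; Same u is the tree of u.
  record ForestRepresentation {k d : ℕ} (F : Graph k) (i : Fin d) : Set₁ where
    field
      b          : Fin k → Point d
      Same       : Rel (Fin k) 0ℓ
      Same-sym   : ∀ {u v} → Same u v → Same v u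
      Same-trans : ∀ {u v w} → Same u v → Same v w → Same u w
      adj⇒same   : ∀ {u v} → Adj F u v → Same u v
      adj⇒sees   : ∀ {u v} → Adj F u v → Sees b i (Same u) u v
      sees⇒adj   : ∀ {u v} → Same u v → u ≢ v → Sees b i (Same u) u v → Adj F u v
      distinct   : ∀ u p → DistinctHeights b i (Same u) p

  module _ {m k : ℕ} {F : Graph k} (i : Fin (ℕ.suc m)) (forest : IsOrthogonalVisibilityForest m F) where

    private
      K = proj₁ (proj₂ forest)
      union = proj₁ (proj₂ (proj₂ forest))
      separate = proj₁ (proj₂ (proj₂ (proj₂ forest)))
      represent = λ c → proj₂ (proj₂ (proj₂ (proj₂ (proj₂ forest))) c)
      panels = λ c → proj₁ (represent c)
      module Union = _IsUnionOf_ union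

      σ τ : Fin (ℕ.suc m) → Fin (ℕ.suc m)
      σ = transpose i top
      τ = transpose top i

      merged : ∀ {v} → Dec (∃[ c ] v ∈ V (K c)) → Point (ℕ.suc m)
      merged {v} (yes (c , _)) = panels c v
      -- An arbitrary point: a vertex outside all trees is not related to anything by `Same`.
      merged     (no _)        = const 0#

      b : Fin k → Point (ℕ.suc m)
      b v = merged (excludedMiddle (∃[ c ] v ∈ V (K c))) ∘ σ

      merged-component : ∀ {v c} (d : Dec (∃[ c ] v ∈ V (K c))) → v ∈ V (K c) → merged d ≡ panels c v
      merged-component {v} {c} (yes (c′ , v∈′)) v∈ with c′ ≟ c
      ... | yes ≡.refl = ≡.refl
      ... | no c′≢c    = contradiction (v∈′ , v∈) (separate c′≢c)
      merged-component (no ∄) v∈ = contradiction (_ , v∈) ∄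

      b-component : ∀ {v c} → v ∈ V (K c) → ∀ j → b v j ≡ panels c v (σ j)
      b-component v∈ j = ≡.cong (λ p → p (σ j)) (merged-component (excludedMiddle _) v∈)

      -- Only a partial equivalence, since a vertex in no tree is not related to itself.
      -- Transitivity rests on the disjointness of the trees.
      Same : Rel (Fin k) 0ℓ
      Same u v = ∃[ c ] u ∈ V (K c) × v ∈ V (K c)

      same⇒∈ : ∀ {u v c} → u ∈ V (K c) → Same u v → v ∈ V (K c)
      same⇒∈ {c = c} u∈ (c′ , u∈′ , v∈) with c′ ≟ c
      ... | yes ≡.refl = v∈
      ... | no c′≢c    = contradiction (u∈′ , u∈) (separate c′≢c)

      adj⇒sees : ∀ {u v} → Adj F u v → Sees b i (Same u) u v
      adj⇒sees {u} {v} u~v = Sees-⊆ {W = V (K c)} (same⇒∈ u∈) (Sees-cong b-component u∈ v∈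
        (Sees-permute σ τ (λ j → transpose-inverse i top) (λ j → transpose-inverse top i) (transpose-matchˡ i top)
          (panel-seesAlong⇒sees u∈ v∈ u≢v (Equivalence.to (proj₂ (proj₂ (represent c)) u∈ v∈ u≢v) u~ᶜv))))
        where
        c = proj₁ (Union.Adj-cover u~v)
        u~ᶜv = proj₂ (Union.Adj-cover u~v)
        u∈ = Adj⇒V (K c) u~ᶜv
        v∈ = Adj⇒V (K c) (Adj-sym (K c) u~ᶜv)
        u≢v : u ≢ v
        u≢v u≡v = Adj-irrefl F {u} (≡.subst (Adj F u) (≡.sym u≡v) u~v)
        open Panels (K c) (panels c)

      sees⇒adj : ∀ {u v} → Same u v → u ≢ v → Sees b i (Same u) u v → Adj F u v
      sees⇒adj {u} {v} (c , u∈ , v∈) u≢v sees = _IsSubgraphOf_.Adj-⊆ (Union.subgraph c)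
        (Equivalence.from (proj₂ (proj₂ (represent c)) u∈ v∈ u≢v) (panel-sees⇒seesAlong u∈ v∈ u≢v
          (Sees-cong {a = λ w → b w ∘ τ} unpermute u∈ v∈
            (Sees-permute τ σ (λ j → transpose-inverse top i) (λ j → transpose-inverse i top) (transpose-matchˡ top i)
              (Sees-⊆ {W = Same u} (λ w∈ → c , u∈ , w∈) sees)))))
        where
        open Panels (K c) (panels c)
        unpermute : ∀ {w} → w ∈ V (K c) → ∀ j → panels c w j ≡ b w (τ j)
        unpermute {w} w∈ j = ≡.trans (≡.cong (panels c w) (≡.sym (transpose-inverse i top)))
          (≡.sym (b-component w∈ (τ j)))

      distinct : ∀ u p → DistinctHeights b i (Same u) p
      distinct u p {x} {y} (c , u∈ , x∈) same-y x≢y covˣ covʸ x≈y =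
        panel-distinctHeights (λ {u} {v} → proj₁ (proj₂ (represent c)) {u} {v}) (p ∘ τ) x∈ y∈ x≢y
          (permute x x∈ covˣ) (permute y y∈ covʸ)
          (≡.subst₂ _≈_ (height x∈) (height y∈) x≈y)
        where
        open Panels (K c) (panels c)
        y∈ = same⇒∈ u∈ same-y
        height : ∀ {w} → w ∈ V (K c) → b w i ≡ panels c w top
        height {w} w∈ = ≡.trans (b-component w∈ i) (≡.cong (panels c w) (transpose-matchˡ i top))
        permute : ∀ w → w ∈ V (K c) → Covers i (b w) p → Covers top (panels c w) (p ∘ τ)
        permute w w∈ cov {j} j≢top = ≡.subst (λ x → x ≤ p (τ j) × p (τ j) ≤ x + 1#)
          (≡.trans (b-component w∈ (τ j)) (≡.cong (panels c w) (transpose-inverse i top)))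
          (cov λ τj≡i → j≢top (≡.trans (≡.sym (transpose-inverse i top))
            (≡.trans (≡.cong σ τj≡i) (transpose-matchˡ i top))))

    forestRepresentation : ForestRepresentation F i
    forestRepresentation = record
      { b          = b
      ; Same       = Same
      ; Same-sym   = λ (c , u∈ , v∈) → c , v∈ , u∈
      ; Same-trans = λ (c , u∈ , v∈) v-w → c , u∈ , same⇒∈ v∈ v-w
      ; adj⇒same   = λ u~v → let c , u~ᶜv = Union.Adj-cover u~v in
                             c , Adj⇒V (K c) u~ᶜv , Adj⇒V (K c) (Adj-sym (K c) u~ᶜv)
      ; adj⇒sees   = adj⇒sees
      ; sees⇒adj   = sees⇒adj
      ; distinct   = distinct
      }

-- Placing the cubes, and comparing their views with those of the panels.

module Assembly (ℝ : CompleteOrderedField) where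
  open OrderedField ℝ
  open Visibility ℝ
  open Classical excludedMiddle
  open Geometry ℝ
  open Views ℝ
  open Potentials ℝ
  open Backward ℝ

  module _ {m k : ℕ} (T : Graph k) (tree : IsTree T) (H : Fin (ℕ.suc m) → Graph k) (union : T IsUnionOf H)
           (representation : ∀ i → ForestRepresentation (H i) i) where

    private
      n = ℕ.suc m
      acyclic = proj₂ tree
      connected = proj₂ (proj₁ tree)
      module Union = _IsUnionOf_ union
      module H i = ForestRepresentation {F = H i} (representation i)

      H⊆T : ∀ i {u v} → Adj (H i) u v → Adj T u v
      H⊆T i = _IsSubgraphOf_.Adj-⊆ (Union.subgraph i)

      -- An edge that lies in several of the H i gets the least such i as its colour.
      E : Fin n → Rel (Fin k) 0ℓ
      E i u v = Adj (H i) u v × (∀ {j} → Adj (H j) u v → ¬ j <ᶠ i)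

      E⇒Adj : ∀ {i u v} → E i u v → Adj T u v
      E⇒Adj {i} (u~v , _) = H⊆T i u~v

      E-sym : ∀ {i u v} → E i u v → E i v u
      E-sym {i} (u~v , first) = Adj-sym (H i) u~v , λ {j} v~u → first (Adj-sym (H j) v~u)

      E-unique : ∀ {i j u v} → E i u v → E j u v → i ≡ j
      E-unique {i} {j} (u~ⁱv , firstⁱ) (u~ʲv , firstʲ) with <ᶠ-cmp i j
      ... | tri< i<j _ _ = contradiction i<j (firstʲ u~ⁱv)
      ... | tri≈ _ i≡j _ = i≡j
      ... | tri> _ _ j<i = contradiction j<i (firstⁱ u~ʲv)

      Adj⇒E : ∀ {u v} → Adj T u v → ∃[ i ] E i u v
      Adj⇒E {u} {v} u~v = least {P = λ i → Adj (H i) u v} (proj₂ (Union.Adj-cover u~v))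

      open Coloured acyclic E⇒Adj E-sym E-unique Adj⇒E

      Mono : Fin n → Rel (Fin k) 0ℓ
      Mono i = Star (E i)

      Mono-sym : ∀ {i u v} → Mono i u v → Mono i v u
      Mono-sym = Star.reverse E-sym

      Mono⇒Blob : ∀ {i j u v} → i ≢ j → Mono i u v → Blob j u v
      Mono⇒Blob i≢j = Star.map (λ e → _ , i≢j , e)

      -- The premise `H.Same i u u` serves the empty path, as `u` might lie outside the forest. A
      -- nonempty path provides it through its first edge, which gives `Mono⇒Same′`.
      Mono⇒Same : ∀ {i u v} → H.Same i u u → Mono i u v → H.Same i u v
      Mono⇒Same {i} same ε        = same
      Mono⇒Same {i} same (e ◅ es) = H.Same-trans i u-w (Mono⇒Same (H.Same-trans i (H.Same-sym i u-w) u-w) es)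
        where u-w = H.adj⇒same i (proj₁ e)

      Mono⇒Same′ : ∀ {i u v} → u ≢ v → Mono i u v → H.Same i u v
      Mono⇒Same′ u≢v ε = contradiction ≡.refl u≢v
      Mono⇒Same′ {i} u≢v walk@(e ◅ _) = Mono⇒Same (H.Same-trans i u-w (H.Same-sym i u-w)) walk
        where u-w = H.adj⇒same i (proj₁ e)

      -- Every edge of colour `i` prescribes the displacement of its ends in the representation of
      -- `H i`. Acyclicity allows all these prescriptions to be met at once.
      module Lateral (j : Fin n) = Potential acyclic E⇒Adj E-sym E-unique (λ i v → H.b i v j)

      P : Fin k → Fin n → Carrier
      P v j = Lateral.potential j v

      module Height (i : Fin n) where

        private
          height : Fin n → Fin k → Carrier
          -- Only edges of colour `i` contribute to the height, which makes `φ` constant on the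
          -- blobs of `i`.
          height c v = select (c ≟ i) (H.b i v i) 0#

          open Potential acyclic E⇒Adj E-sym E-unique height

        φ : Fin k → Carrier
        φ = potential

        φ-const : ∀ {u v} → Blob i u v → φ u ≈ φ v
        φ-const ε = refl
        φ-const {u} (_◅_ {j = v} (c , c≢i , e) walk) = trans (+-cancelʳ-≈ (- 0#) (trans (+-congˡ (-‿cong (zero-height u)))
          (trans (sym (potential-step e)) (+-congˡ (-‿cong (sym (zero-height v))))))) (φ-const walk)
          where
          zero-height : ∀ w → 0# ≈ height c w
          zero-height w = sym (select-no (c ≟ i) c≢i)

        φ-increasing : ∀ {u v} → Mono i u v → H.b i u i < H.b i v i → φ u < φ v
        φ-increasing {u} {v} walk u<v = <-respˡ-≈ (x-z+z≈x _ _) (<-respʳ-≈ (trans (+-congʳ same) (x-z+z≈x _ _))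
          (+-monoʳ-< (φ u - height i u)
            (<-respˡ-≈ (sym (own-height u)) (<-respʳ-≈ (sym (own-height v)) u<v))))
          where
          own-height : ∀ w → height i w ≈ H.b i w i
          own-height w = select-yes (i ≟ i) ≡.refl
          same : φ u - height i u ≈ φ v - height i v
          same = sym (potential-monochromatic walk)

        bound = upperBound λ u → proj₁ (upperBound λ v → P u i - P v i)

        B M : Carrier
        B = proj₁ bound
        -- `B` outweighs any difference of the lateral positions, one unit accounts for the width of
        -- a cube, and one makes the separation strict.
        M = (B + 1#) + 1#

        P≤P+B : ∀ u v → P u i ≤ P v i + B
        P≤P+B u v = ≤-trans (≈⇒≤ (sym (x-z+z≈x (P u i) (P v i)))) (≤-trans (+-monoˡ-≤ (P v i) (≤-trans
          (proj₂ (proj₂ (upperBound λ v → P u i - P v i)) v) (proj₂ (proj₂ bound) u))) (≈⇒≤ (+-comm _ _)))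

        0<M : 0# < M
        0<M = <-trans (<-trans (proj₁ (proj₂ bound)) (x<x+y _ 0<1)) (x<x+y _ 0<1)

        open Spread Blob-isEquivalence φ φ-const 0<M public

        gap : ∀ {u v} → ψ u + M ≤ ψ v → (P u i + ψ u) + 1# < P v i + ψ v
        gap {u} {v} ψu+M≤ψv = begin-strict
          (P u i + ψ u) + 1#              ≤⟨ +-monoˡ-≤ 1# (+-monoˡ-≤ (ψ u) (P≤P+B u v)) ⟩
          ((P v i + B) + ψ u) + 1#        <⟨ x<x+y _ 0<1 ⟩
          (((P v i + B) + ψ u) + 1#) + 1# ≈⟨ +-assoc _ _ _ ⟩
          ((P v i + B) + ψ u) + (1# + 1#) ≈⟨ +-congʳ (trans (+-assoc _ _ _) (+-congˡ (+-comm _ _))) ⟩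
          (P v i + (ψ u + B)) + (1# + 1#) ≈⟨ +-assoc _ _ _ ⟩
          P v i + ((ψ u + B) + (1# + 1#)) ≈⟨ +-congˡ (trans (+-assoc _ _ _) (+-congˡ (sym (+-assoc _ _ _)))) ⟩
          P v i + (ψ u + M)               ≤⟨ +-monoʳ-≤ (P v i) ψu+M≤ψv ⟩
          P v i + ψ v                     ∎
          where open ≤-Reasoning

      X : Fin k → Point n
      X v j = P v j + Height.ψ j v

      far : ∀ {j u v} → ¬ Blob j u v → X u j + 1# < X v j ⊎ X v j + 1# < X u j
      far {j} ¬blob = ⊎-map (Height.gap j) (Height.gap j) (Height.ψ-separated j ¬blob)

      far⇒uncovered : ∀ {j u v x} → ¬ Blob j u v → X u j ≤ x → x ≤ X u j + 1# → X v j ≤ x → ¬ x ≤ X v j + 1#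
      far⇒uncovered ¬blob u≤x x≤u+1 v≤x x≤v+1 =
        [ (λ u+1<v → <⇒≱ u+1<v (≤-trans v≤x x≤u+1)) , (λ v+1<u → <⇒≱ v+1<u (≤-trans u≤x x≤v+1)) ]′ (far ¬blob)

      X-increasing : ∀ {i u v} → Mono i u v → H.b i u i < H.b i v i → X u i < X v i
      X-increasing {i} walk u<v = <-trans (x<x+y _ 0<1)
        (Height.gap i (Height.ψ-increasing i (Height.φ-increasing i walk u<v)))

      -- The converse can fail, as `X` breaks ties between equal heights. On a single line
      -- `distinct` excludes such ties, which is how `lower` recovers it.
      X-reflects : ∀ {i u v} → Mono i u v → X u i ≤ X v i → H.b i u i ≤ H.b i v i
      X-reflects walk u≤v = ≮⇒≥ λ v<u → <⇒≱ (X-increasing (Mono-sym walk) v<u) u≤v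

      X-apart : ∀ {i u v} → u ≢ v → Mono i u v → ¬ (X u i ≈ X v i)
      X-apart u≢v walk u≈v =
        [ <-irrefl u≈v ∘ <-trans (x<x+y _ 0<1) , <-irrefl (sym u≈v) ∘ <-trans (x<x+y _ 0<1) ]′
          (far (monochromatic⇒¬Blob u≢v walk))

      -- Some coordinate other than `i` separates the two cubes by more than their width, so no line
      -- parallel to the `i`-th axis meets both.
      ¬Mono⇒uncovered : ∀ {i u w p} → u ∈ V T → w ∈ V T → ¬ Mono i u w → Covers i (X u) p → ¬ Covers i (X w) p
      ¬Mono⇒uncovered u∈V w∈V ¬mono covᵘ covʷ =
        let j , j≢i , ¬blob = ¬monochromatic⇒¬Blob (connected u∈V w∈V) ¬mono in
        far⇒uncovered ¬blob (proj₁ (covᵘ j≢i)) (proj₂ (covᵘ j≢i)) (proj₁ (covʷ j≢i)) (proj₂ (covʷ j≢i))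

      module _ (i : Fin n) (u : Fin k) where
        open H i using (b; Same; Same-sym; Same-trans; sees⇒adj; distinct)

        t : Point n
        t j = (P u j - b u j) + Height.ψ j u

        -t : Point n
        -t j = - t j

        -- Along a path of colour `i` the difference between `P` and `b` is constant, by the choice
        -- of the potential. For `j ≢ i` the path stays in one blob of `j`, so `ψ` is constant too.
        b⇒X : ∀ {w j} → w ∈ Mono i u → j ≢ i → X w j ≈ b w j + t j
        b⇒X {w} {j} walk j≢i = begin-equality
          P w j + Height.ψ j w
            ≈⟨ +-cong (x-z+z≈x _ _) (Height.ψ-cong j (Mono⇒Blob (j≢i ∘ ≡.sym) walk)) ⟨
          ((P w j - b w j) + b w j) + Height.ψ j u  ≈⟨ +-congʳ (+-comm _ _) ⟩
          (b w j + (P w j - b w j)) + Height.ψ j u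
            ≈⟨ +-congʳ (+-congˡ (Lateral.potential-monochromatic j walk)) ⟩
          (b w j + (P u j - b u j)) + Height.ψ j u  ≈⟨ +-assoc _ _ _ ⟩
          b w j + t j                               ∎
          where open ≤-Reasoning

        X⇒b : ∀ {w j} → w ∈ Mono i u → j ≢ i → b w j ≈ X w j + -t j
        X⇒b {j = j} walk j≢i = trans (sym (x+z-z≈x _ (t j))) (+-congʳ (sym (b⇒X walk j≢i)))

        module ToX = Translation {a = b} {X} {i} {Mono i u} t b⇒X
        module ToB = Translation {a = X} {b} {i} {Mono i u} -t X⇒b

        Mono-between : ∀ {x y} → x ∈ Mono i u → y ∈ Mono i u → Mono i x y
        Mono-between walkˣ walkʸ = Mono-sym walkˣ ◅◅ walkʸ

        -- Cubes of the monochromatic component are translated panels in the same order, so they do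
        -- not block. All other cubes miss the line by `¬Mono⇒uncovered`.
        lift : ∀ {v} → u ∈ V T → u ≢ v → v ∈ Mono i u → Sees b i (Mono i u) u v → Sees X i (V T) u v
        lift {v} u∈V u≢v v∈ (p , s) = q , record
          { coversˡ = coversˡ
          ; coversʳ = coversʳ
          ; apart   = apart
          ; clear   = λ {w} w∈V w≢u w≢v cov → blocked w w∈V w≢u w≢v cov (excludedMiddle (Mono i u w))
          }
          where
          q = ToX.shifted p
          reflect : ∀ {x y} → x ∈ Mono i u → y ∈ Mono i u → X x i ≤ X y i → b x i ≤ b y i
          reflect x∈ y∈ = X-reflects (Mono-between x∈ y∈)
          open SeesAt (ToX.SeesAt-shift ε v∈ (X-apart u≢v v∈)
            (λ w∈ _ _ _ → ⊎-map (λ (p , q) → reflect ε w∈ p , reflect w∈ v∈ q)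
                                  (λ (p , q) → reflect v∈ w∈ p , reflect w∈ ε q)) s)
          blocked : ∀ w → w ∈ V T → w ≢ u → w ≢ v → Covers i (X w) q → Dec (Mono i u w) →
                    ¬ Between (X u i) (X w i) (X v i)
          blocked w w∈V w≢u w≢v cov (yes w∈) = clear w∈ w≢u w≢v cov
          blocked w w∈V w≢u w≢v cov (no w∉) _ =
            ¬Mono⇒uncovered {p = q} u∈V w∈V w∉ (open⇒covers {a = X u} {q} coversˡ) cov

        -- A panel blocking the translated line has a height distinct from those of `u` and `v`,
        -- because all three lie in one tree and on one line. Its cube is then strictly between
        -- theirs and blocks as well.
        lower : ∀ {v} → u ∈ V T → u ≢ v → v ∈ Mono i u → Sees X i (V T) u v → Sees b i (Mono i u) u v
        lower {v} u∈V u≢v v∈ (p , s) = q , ToB.SeesAt-shift ε v∈ apart′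
          (λ {w} w∈ w≢u w≢v cov → let covʷ = ToB.covers-shift {w} {p} w∈ cov in
            ⊎-map (λ (p , q) → preserve ε w∈ (w≢u ∘ ≡.sym) covᵘ covʷ p , preserve w∈ v∈ w≢v covʷ covᵛ q)
                    (λ (p , q) → preserve v∈ w∈ (w≢v ∘ ≡.sym) covᵛ covʷ p , preserve w∈ ε w≢u covʷ covᵘ q)) s′
          where
          s′ : SeesAt X i (Mono i u) u v p
          s′ = record { SeesAt s ; clear = λ w∈ → SeesAt.clear s (reachable∈V T u∈V (Star.map E⇒Adj w∈)) }
          q = ToB.shifted p
          same : ∀ {w} → w ∈ Mono i u → w ∈ Same u
          same = Mono⇒Same (Same-trans u-v (Same-sym u-v))
            where u-v = Mono⇒Same′ u≢v v∈
          covᵘ : Covers i (b u) q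
          covᵘ = ToB.covers-shift {u} {p} ε (open⇒covers {a = X u} {p} (SeesAt.coversˡ s))
          covᵛ : Covers i (b v) q
          covᵛ = ToB.covers-shift {v} {p} v∈ (open⇒covers {a = X v} {p} (SeesAt.coversʳ s))
          apart′ : ¬ (b u i ≈ b v i)
          apart′ = distinct u q (same ε) (same v∈) u≢v covᵘ covᵛ
          preserve : ∀ {x y} → x ∈ Mono i u → y ∈ Mono i u → x ≢ y → Covers i (b x) q → Covers i (b y) q →
                     b x i ≤ b y i → X x i ≤ X y i
          preserve x∈ y∈ x≢y covˣ covʸ x≤y = <⇒≤ (X-increasing (Mono-between x∈ y∈)
            (≤∧≉⇒< x≤y (distinct u q (same x∈) (same y∈) x≢y covˣ covʸ)))

        module _ {v p} (u-v : Same u v) (generic : Generic b i p) (covᵛ : Covers i (b v) p) where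

          -- Repeated use of `next` leads from panel to panel up to `v`; there are finitely many
          -- panels, so this terminates. The steps are edges of `H i` of any colour, and all panels
          -- passed are above `u`, hence different from it.
          climb : ∀ {z} → Acc (flip (Below b i)) z → Same u z → Covers i (b z) p → b u i < b z i → b z i ≤ b v i →
                  Star (Avoiding (Adj T) u) z v
          climb {z} (acc above) u-z covᶻ u<z z≤v with z ≟ v
          ... | yes ≡.refl = ε
          ... | no z≢v
            with next b i {Same u} generic (distinct u p) u-z covᶻ u-v covᵛ
                   (≤∧≉⇒< z≤v (distinct u p u-z u-v z≢v covᶻ covᵛ))
          ... | y , u-y , covʸ , z<y , y≤v , s =
            (H⊆T i z~y , higher u<z , higher (<-trans u<z z<y)) ◅ climb (above z<y) u-y covʸ (<-trans u<z z<y) y≤v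
            where
            higher : ∀ {x y} → b x i < b y i → y ≢ x
            higher x<y ≡.refl = <-irrefl refl x<y
            z~y : Adj (H i) z y
            z~y = sees⇒adj (Same-trans (Same-sym u-z) u-y) (higher z<y ∘ ≡.sym)
              (Sees-⊆ {W = Same u} (Same-trans u-z) (p , s))

        -- The panel z just above u is joined to v by a chain of panels above u.  If uz had another
        -- colour than i, this chain and the monochromatic path from u to v would bypass the bridge uz.
        upward : ∀ {v p} → u ≢ v → v ∈ Mono i u → Generic b i p → SeesAt b i (Mono i u) u v p →
                 b u i < b v i → Adj T u v
        upward {v} {p} u≢v v∈ generic s u<v
          with next b i {Same u} generic (distinct u p) (Same-trans u-v (Same-sym u-v))
                 (open⇒covers {a = b u} {p} (SeesAt.coversˡ s)) u-v (open⇒covers {a = b v} {p} (SeesAt.coversʳ s)) u<v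
          where u-v = Mono⇒Same′ u≢v v∈
        ... | z , u-z , covᶻ , u<z , z≤v , sᶻ with z ≟ v
        ... | yes ≡.refl = H⊆T i (sees⇒adj u-z u≢v (p , sᶻ))
        ... | no z≢v with Adj⇒E (H⊆T i (sees⇒adj u-z (λ { ≡.refl → <-irrefl refl u<z }) (p , sᶻ)))
        ... | j , e with j ≟ i
        ... | yes ≡.refl = contradiction (inj₁ (<⇒≤ u<z , z≤v))
          (SeesAt.clear s (e ◅ ε) (λ { ≡.refl → <-irrefl refl u<z }) z≢v covᶻ)
        ... | no j≢i = contradiction (Mono⇒Blob (j≢i ∘ ≡.sym) v∈) (detour e
          (climb (Mono⇒Same′ u≢v v∈) generic (open⇒covers {a = b v} {p} (SeesAt.coversʳ s))
            (Above-wellFounded b i z) u-z covᶻ u<z z≤v))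

      adj⇒sees : ∀ {i u v} → u ∈ V T → u ≢ v → E i u v → Sees X i (V T) u v
      adj⇒sees {i} {u} {v} u∈V u≢v e = lift i u u∈V u≢v (e ◅ ε)
        (Sees-⊆ {W = H.Same i u} (Mono⇒Same (H.Same-trans i u-v (H.Same-sym i u-v))) (H.adj⇒sees i (proj₁ e)))
        where u-v = H.adj⇒same i (proj₁ e)

      sees⇒mono : ∀ {i u v} → u ∈ V T → v ∈ V T → Sees X i (V T) u v → Mono i u v
      sees⇒mono {u = u} {v} u∈V v∈V (q , s) = decidable-stable (excludedMiddle _) λ v∉ →
        ¬Mono⇒uncovered {p = q} u∈V v∈V v∉
          (open⇒covers {a = X u} {q} (SeesAt.coversˡ s)) (open⇒covers {a = X v} {q} (SeesAt.coversʳ s))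

      -- The tree of `H i` may contain edges of other colours, so its panels outside the
      -- monochromatic component could block the view. `upward` shows that adjacency follows
      -- nevertheless; it is applied from the lower of the two vertices.
      mono-sees⇒adj : ∀ {i u v} → u ≢ v → Mono i u v → Sees (H.b i) i (Mono i u) u v → Adj T u v
      mono-sees⇒adj {i} {u} {v} u≢v v∈ sees = ordered (SeesAt-generic sees)
        where
        ordered : ∃[ p ] Generic (H.b i) i p × SeesAt (H.b i) i (Mono i u) u v p → Adj T u v
        ordered (p , generic , s) = [ upward i u u≢v v∈ generic s
          , Adj-sym T ∘ upward i v (u≢v ∘ ≡.sym) (Mono-sym v∈) generic (record
              { SeesAt (SeesAt-sym s) ; clear = λ w∈ → SeesAt.clear (SeesAt-sym s) (v∈ ◅◅ w∈) }) ]′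
          (≉⇒<⊎> (SeesAt.apart s))

      sees⇒adj : ∀ {i u v} → u ∈ V T → v ∈ V T → u ≢ v → Sees X i (V T) u v → Adj T u v
      sees⇒adj {i} {u} u∈V v∈V u≢v sees = mono-sees⇒adj u≢v v∈ (lower i u u∈V u≢v v∈ sees)
        where v∈ = sees⇒mono u∈V v∈V sees

      somewhere-apart : ∀ {u v} → u ∈ V T → v ∈ V T → u ≢ v → ∃[ j ] ¬ Blob j u v
      -- Any colour would do. A path of that colour separates its distinct ends in that coordinate;
      -- without one, another coordinate separates them.
      somewhere-apart {u} {v} u∈V v∈V u≢v with excludedMiddle (Mono zero u v)
      ... | yes v∈ = zero , monochromatic⇒¬Blob u≢v v∈
      ... | no v∉ = let j , _ , ¬blob = ¬monochromatic⇒¬Blob (connected u∈V v∈V) v∉ in j , ¬blob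

      cubes-disjoint : PairwiseDisjoint T (λ v → Cube (X v))
      cubes-disjoint u∈V v∈V u≢v (x∈u , x∈v) = let j , ¬blob = somewhere-apart u∈V v∈V u≢v in
        far⇒uncovered ¬blob (proj₁ (x∈u j)) (proj₂ (x∈u j)) (proj₁ (x∈v j)) (proj₂ (x∈v j))

    assemble : IsCubeVisibilityGraph (ℕ.suc m) T
    assemble = X , cubes-disjoint , λ u∈V v∈V u≢v → mk⇔
      (λ u~v → let i , e = Adj⇒E u~v in
        i , Cubes.cube-sees⇒seesAlong T X i cubes-disjoint u∈V v∈V u≢v (adj⇒sees u∈V u≢v e))
      (λ (i , s) → sees⇒adj u∈V v∈V u≢v (Cubes.cube-seesAlong⇒sees T X i cubes-disjoint u∈V v∈V u≢v s))

open import Data.Nat using (ℕ; _≤_; pred)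

theorem3 : (ℝ : CompleteOrderedField) → let open Visibility ℝ in
    (n : ℕ) → 1 ≤ n → {k : ℕ} (T : Graph k) → IsTree T →
    IsCubeVisibilityGraph n T ⇔
    (Σ[ H ∈ (Fin n → Graph k) ]
    T IsUnionOf H × (∀ i → IsOrthogonalVisibilityForest (pred n) (H i)))
theorem3 ℝ (ℕ.suc m) (s≤s z≤n) T tree = mk⇔
  (decompose T (proj₂ tree))
  (λ (H , union , forests) → assemble T tree H union (λ i → forestRepresentation i (forests i)))
  where
  open Forward ℝ using (decompose)
  open Backward ℝ using (forestRepresentation)
  open Assembly ℝ using (assemble)
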